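{- Let $k,l,m$ be positive integers with $m\geq 3$ and $\frac{2l-1}{2k-1}\leq 1$. Then $\theta(H(m,1,k)^{2l-1})=\frac{2k-1}{2l-1}$.
   Context: For a positive integer $t$, $G^{t}$ has vertex set $V(G)$, with $u,v$ adjacent iff there is a walk of length $t$ between them in $G$. $S_t(G)$ replaces each edge by a path with exactly $t-1$ inner vertices, and for non-negative integers $r,s$, $G^{\frac{2r+1}{2s+1}}:=(S_{2s+1}(G))^{2r+1}$. $og(G)$ is the odd girth. For a non-bipartite graph $G$, the power thickness is $\theta(G):=\sup\{\frac{2r+1}{2s+1}: r,s\ge 0 \text{ integers},\ \chi(G^{\frac{2r+1}{2s+1}})\le\chi(G),\ \frac{2r+1}{2s+1}<og(G)\}$. For positive integers $m,n,k$ with $m\ge 2n$, the helical graph $H(m,n,k)$ has as vertices all $k$-tuples $(A_1,\ldots,A_k)$ of subsets of $\{1,\ldots,m\}$ with $|A_1|=n$, $|A_i|\ge n$ for all $i$, $A_i\cap A_{i+1}=\emptyset$ for $i\le k-1$, and $A_t\subseteq A_{t+2}$ for $t\le k-2$; $(A_1,\ldots,A_k)$ and $(B_1,\ldots,B_k)$ are adjacent iff $A_i\cap B_i=\emptyset$ for all $1\le i\le k$ and $A_j\subseteq B_{j+1}$, $B_j\subseteq A_{j+1}$ for all $1\le j\le k-1$. -}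

module Defs where

open import Data.Nat using (ℕ; zero; suc; _+_; _*_; _∸_; _≤_; _<_)
open import Data.Bool using (Bool; true; false; if_then_else_)
open import Data.Fin using (Fin; toℕ)
open import Data.Fin.Subset using (Subset; _∩_; _⊆_; Empty; ∣_∣)
open import Data.Vec using (Vec; lookup; concat; toList)
open import Data.List using (List; []; _∷_)
open import Data.Product using (_×_; ∃; _,_)
open import Data.Sum using (_⊎_)
open import Data.Irrelevant using (Irrelevant)
open import Relation.Nullary using (¬_)
open import Relation.Binary.PropositionalEquality using (_≡_; _≢_)

record Graph : Set₁ where
  field
    V   : Set
    _~_ : V → V → Set
open Graph public

data Walk (G : Graph) : ℕ → V G → V G → Set where
  []  : ∀ {u} → Walk G 0 u u
  _∷_ : ∀ {t u w v} → _~_ G u w → Walk G t w v → Walk G (suc t) u v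

_^ᵍ_ : Graph → ℕ → Graph
G ^ᵍ t = record { V = V G ; _~_ = λ u v → Walk G t u v }

-- Subdivision S_n(G): every edge replaced by a path with n - 1 inner
-- vertices.  To take each (unordered) edge exactly once we use an
-- injective key V → ℕ and orient each edge {u,v} from smaller key to
-- larger key; the adjacency witness is irrelevant so that each edge
-- gives exactly one path.

module _ (G : Graph) (key : V G → ℕ) (n : ℕ) where

  record Edge : Set where
    constructor edge
    field
      src tgt : V G
      lt      : key src < key tgt
      adj     : Irrelevant (_~_ G src tgt)

  data SVert : Set where
    orig  : V G → SVert
    inner : (e : Edge) (i : ℕ) → 1 ≤ i → i < n → SVert

  data At (e : Edge) : ℕ → SVert → Set where
    atSrc : At e 0 (orig (Edge.src e))
    atTgt : At e n (orig (Edge.tgt e))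
    atIn  : ∀ i (p : 1 ≤ i) (q : i < n) → At e i (inner e i p q)

  SAdj : SVert → SVert → Set
  SAdj x y = ∃ λ (e : Edge) → ∃ λ (i : ℕ) →
    (At e i x × At e (suc i) y) ⊎ (At e (suc i) x × At e i y)

  Subdivide : Graph
  Subdivide = record { V = SVert ; _~_ = SAdj }

PowerFrac : (G : Graph) → (V G → ℕ) → ℕ → ℕ → Graph
PowerFrac G key r s = Subdivide G key (suc (2 * s)) ^ᵍ suc (2 * r)

Colorable : Graph → ℕ → Set
Colorable G c = ∃ λ (f : V G → Fin c) → ∀ u v → _~_ G u v → f u ≢ f v

IsChromaticNumber : Graph → ℕ → Set
IsChromaticNumber G c = Colorable G c × (∀ c' → Colorable G c' → c ≤ c')

-- χ(H) ≤ χ(G)   (vacuous if G has no finite colouring, i.e. χ(G) = ∞)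
χ≤χ : Graph → Graph → Set
χ≤χ H G = ∀ c → IsChromaticNumber G c → Colorable H c

NonBipartite : Graph → Set
NonBipartite G = ¬ Colorable G 2

OddCycle : Graph → ℕ → Set
OddCycle G n =
  (∃ λ t → n ≡ suc (2 * t)) × 3 ≤ n ×
  ∃ λ (f : Fin n → V G) →
    (∀ i j → f i ≡ f j → i ≡ j) ×
    (∀ i j → (toℕ j ≡ suc (toℕ i)) ⊎ (toℕ i ≡ n ∸ 1 × toℕ j ≡ 0) →
             _~_ G (f i) (f j))

BelowOddGirth : Graph → ℕ → ℕ → Set
BelowOddGirth G r s = ∀ n → OddCycle G n → suc (2 * r) < n * suc (2 * s)

-- Power thickness.  θ(G) = p / q  (q > 0) means: G is non-bipartite and
-- p/q is the supremum of the admissible fractions (2r+1)/(2s+1).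

Admissible : (G : Graph) → (V G → ℕ) → ℕ → ℕ → Set
Admissible G key r s = χ≤χ (PowerFrac G key r s) G × BelowOddGirth G r s

PowerThicknessIs : (G : Graph) → (V G → ℕ) → ℕ → ℕ → Set
PowerThicknessIs G key p q =
  NonBipartite G ×
  (∀ r s → Admissible G key r s → suc (2 * r) * q ≤ p * suc (2 * s)) ×
  (∀ a b → 0 < b → a * q < p * b →
     ∃ λ r → ∃ λ s → Admissible G key r s × a * suc (2 * s) < suc (2 * r) * b)

-- Helical graphs H(m,n,k); subsets of {1..m} as Subset m, the tuple
-- (A_1,…,A_k) as a Vec indexed by Fin k (A_1 = index 0).

IsHelical : (m n k : ℕ) → Vec (Subset m) k → Set
IsHelical m n k A =
  (∀ (i : Fin k) → toℕ i ≡ 0 → ∣ lookup A i ∣ ≡ n) ×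
  (∀ (i : Fin k) → n ≤ ∣ lookup A i ∣) ×
  (∀ (i j : Fin k) → toℕ j ≡ suc (toℕ i) → Empty (lookup A i ∩ lookup A j)) ×
  (∀ (i j : Fin k) → toℕ j ≡ 2 + toℕ i → lookup A i ⊆ lookup A j)

record HVertex (m n k : ℕ) : Set where
  constructor hv
  field
    sets   : Vec (Subset m) k
    .valid : IsHelical m n k sets

HAdj : ∀ {m n k} → HVertex m n k → HVertex m n k → Set
HAdj {k = k} a b =
  (∀ (i : Fin k) → Empty (lookup A i ∩ lookup B i)) ×
  (∀ (i j : Fin k) → toℕ j ≡ suc (toℕ i) →
     lookup A i ⊆ lookup B j × lookup B i ⊆ lookup A j)
  where
  A = HVertex.sets a
  B = HVertex.sets b

Helical : ℕ → ℕ → ℕ → Graph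
Helical m n k = record { V = HVertex m n k ; _~_ = HAdj }

-- injective key on helical vertices: binary encoding of the bit string
bitsToℕ : List Bool → ℕ
bitsToℕ []       = 0
bitsToℕ (b ∷ bs) = (if b then 1 else 0) + 2 * bitsToℕ bs

hkey : ∀ {m n k} → HVertex m n k → ℕ
hkey v = bitsToℕ (toList (concat (HVertex.sets v)))

{-# OPTIONS --safe #-}
module Submission where

open import Defs
open import Data.Nat using (ℕ; _≤_; _∸_; _*_)
open import Data.Nat using (zero; suc; _+_; _<_; z≤n; s≤s; _≟_; _≤?_; _<?_; NonZero; >-nonZero)
open import Data.Nat.Properties
open import Data.Nat.DivMod
open import Data.Nat.Divisibility using (n∣m*n)
open import Data.Nat.Tactic.RingSolver using (solve-∀)
open import Data.Bool using (Bool; true; false; not; _∧_; _xor_; if_then_else_)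
import Data.Bool.Properties as Bool
open import Data.Bool.Properties using (xor-assoc; xor-comm; xor-same; xor-identityʳ; not-involutive; not-injective; not-distribˡ-xor)
open import Data.Empty using (⊥; ⊥-elim)
open import Data.Fin using (Fin; zero; suc; toℕ; fromℕ; fromℕ<; inject≤)
import Data.Fin.Properties as Fin
open import Data.Fin.Properties using (toℕ<n; toℕ-fromℕ<; toℕ-injective)
open import Data.Fin.Subset using (Subset; _∩_; _⊆_; Empty; ∣_∣; ⁅_⁆) renaming (_∈_ to _∈ˢ_)
open import Data.Fin.Subset.Properties using (nonempty?; _⊆?_; x∈p∩q⁺; x∈p∩q⁻; x∈⁅x⁆; x∈⁅y⁆⇒x≡y; ∣⁅x⁆∣≡1; ∣⊥∣≡0; p⊆q⇒∣p∣≤∣q∣; Empty-unique; ⊆-antisym)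
open import Data.Irrelevant using (Irrelevant; [_])
import Data.List as List
open import Data.List using (List; []; _∷_; _++_; map; length; concatMap; cartesianProduct; cartesianProductWith; allFin; upTo)
open import Data.List.Properties using (map-∘; map-id; length-map)
open import Data.List.Relation.Unary.Any as Any using (Any; here; there)
open import Data.List.Relation.Unary.Any.Properties using (lookup-index; lookup-result)
open import Data.List.Membership.Propositional using (_∈_; _∉_; find; lose)
open import Data.List.Membership.Propositional.Properties using (∈-map⁺; ∈-map⁻; ∈-++⁺ˡ; ∈-++⁺ʳ; ∈-++⁻; ∈-concatMap⁺; ∈-cartesianProduct⁺; ∈-cartesianProductWith⁺; ∈-allFin; ∈-upTo⁺)
open import Data.Product using (∃; _×_; _,_; proj₁; proj₂; swap)
import Data.Sum as Sum
open import Data.Sum using (_⊎_; inj₁; inj₂)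
open import Data.Sum.Properties using (inj₂-injective)
open import Data.Vec using (Vec; []; _∷_; lookup; tabulate; concat; toList)
import Data.Vec.Properties as Vec
open import Data.Vec.Properties using (lookup∘tabulate; []=⇒lookup; lookup⇒[]=; ++-injective)
open import Function using (_∘_)
open import Relation.Binary using (Tri; tri<; tri≈; tri>)
open import Relation.Binary.PropositionalEquality using (_≡_; _≢_; refl; sym; trans; cong; cong₂; subst; subst₂; module ≡-Reasoning)
open import Relation.Nullary using (¬_; Dec; yes; no; does; contradiction; recompute)
open import Relation.Nullary.Decidable using (_×-dec_; _→-dec_; ¬?; map′; dec-true; ¬¬-excluded-middle)

-- Write H = H(m,1,k), D = 2k−1, b = 2l−1 and X = H^b.
--
-- Chromatic number.  The grid {x ∈ {0,…,2k}^m : min x = 0, max x = 2k}, with x ~ y iff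
-- x + y is within 1 of (2k,…,2k) in every coordinate, maps to H.  It is an antipodal
-- (m−2)-sphere, and in it one builds chains over F₂ with ∂h_{i+1} = h_i + νh_i, starting
-- from a point: to fill a cycle supported on the first j coordinates, raise coordinate j
-- from the middle value to the maximum and then lower the earlier ones to 0.  As in Fan's
-- lemma the number of alternating simplices of h_i is odd for each i, which is impossible
-- for i = m−2 if there are only m−1 colours.  Hence χ(X) = m.
--
-- Lower bound.  Subdividing the edges of X into b parts gives a graph over H, and first
-- sets differ along walks of length D in H; so (2k−1)/(2l−1) itself is admissible.
--
-- Upper bound.  If X^{u/w} is m-colourable and ub > Dw, universality of H turns the
-- colouring into a homomorphism X^τ → X with τ = ub/(wD) > 1.  This is impossible for a
-- finite non-bipartite graph.  Restricted to a core C of X, endomorphisms are bijective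
-- and so determined at a vertex by their values elsewhere.  Hence, along each edge v v′
-- out of C, the points at odd distance from v all have the same image g(v); at the end
-- of the edge this says that all neighbours v′ of v have the same image, so that X is
-- bipartite.

-- Walks and odd numbers

Odd : ℕ → Set
Odd n = ∃ λ i → n ≡ suc (2 * i)

odd-* : ∀ {m n} → Odd m → Odd n → Odd (m * n)
odd-* (i , refl) (j , refl) = j + i * suc (2 * j) , eq i j
  where
  eq : ∀ i j → suc (2 * i) * suc (2 * j) ≡ suc (2 * (j + i * suc (2 * j)))
  eq = solve-∀

odd-≤ : ∀ {m n} → Odd m → Odd n → m ≤ n → ∃ λ j → n ≡ 2 * j + m
odd-≤ (i , refl) (j , refl) (s≤s le) with m≤n⇒∃[o]m+o≡n (*-cancelˡ-≤ {i} {j} 2 le)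
... | d , refl = d , eq i d
  where
  eq : ∀ i d → suc (2 * (i + d)) ≡ 2 * d + suc (2 * i)
  eq = solve-∀

odd-< : ∀ {m n} → Odd m → Odd n → m < n → 2 + m ≤ n
odd-< (i , refl) (j , refl) (s≤s lt) = s≤s (≤-trans (≤-reflexive (sym (*-suc 2 i))) (*-monoʳ-≤ 2 (*-cancelˡ-< 2 i j lt)))

Sym : Graph → Set
Sym G = ∀ u v → _~_ G u v → _~_ G v u

Hom : (G H : Graph) → (V G → V H) → Set
Hom G H f = ∀ u v → _~_ G u v → _~_ H (f u) (f v)

module _ {G : Graph} where

  _▹▹_ : ∀ {m n u v w} → Walk G m u v → Walk G n v w → Walk G (m + n) u w
  []      ▹▹ q = q
  (e ∷ p) ▹▹ q = e ∷ (p ▹▹ q)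

  walk-split : ∀ m {n u w} → Walk G (m + n) u w → ∃ λ v → Walk G m u v × Walk G n v w
  walk-split zero    p       = _ , [] , p
  walk-split (suc m) (e ∷ p) with v , q , r ← walk-split m p = v , e ∷ q , r

  walk-length : ∀ {m n u v} → m ≡ n → Walk G m u v → Walk G n u v
  walk-length {u = u} {v} = subst (λ n → Walk G n u v)

  walk-power : ∀ b {n u v} → Walk (G ^ᵍ b) n u v → Walk G (n * b) u v
  walk-power b []      = []
  walk-power b (p ∷ q) = p ▹▹ walk-power b q

  power-walk : ∀ b n {u v} → Walk G (n * b) u v → Walk (G ^ᵍ b) n u v
  power-walk b zero    [] = []
  power-walk b (suc n) p with _ , q , r ← walk-split b p = q ∷ power-walk b n r

  module _ (s : Sym G) where

    walk-reverse : ∀ {n u v} → Walk G n u v → Walk G n v u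
    walk-reverse []                  = []
    walk-reverse {suc n} (e ∷ p) = walk-length (+-comm n 1) (walk-reverse p ▹▹ (s _ _ e ∷ []))

    -- Running to and fro on an edge at the start adds two steps. The edge is supplied separately,
    -- since a walk of length 0 has none to offer.
    walk-pad : ∀ {n u v w} j → _~_ G u w → Walk G n u v → Walk G (2 * j + n) u v
    walk-pad zero    e p = p
    walk-pad {n} (suc j) e p = walk-length (cong (_+ n) (sym (*-suc 2 j))) (e ∷ (s _ _ e ∷ walk-pad j e p))

    -- An odd walk has a first edge, on which it can be padded by any even amount.
    walk-≤ : ∀ {m n u v} → Odd m → Odd n → m ≤ n → Walk G m u v → Walk G n u v
    walk-≤ om@(_ , refl) on le p@(e ∷ _) with j , refl ← odd-≤ om on le = walk-pad j e p

power-sym : ∀ {G} b → Sym G → Sym (G ^ᵍ b)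
power-sym b s _ _ = walk-reverse s

walk-map : ∀ {G H} {f : V G → V H} → Hom G H f → ∀ {n u v} → Walk G n u v → Walk H n (f u) (f v)
walk-map h []      = []
walk-map h (e ∷ p) = h _ _ e ∷ walk-map h p

-- Chains over F₂

xor-swap : ∀ a b c → a xor (b xor c) ≡ b xor (a xor c)
xor-swap a b c = trans (sym (xor-assoc a b c)) (trans (cong (_xor c) (xor-comm a b)) (xor-assoc b a c))

xor-cancelˡ : ∀ a b → a xor (a xor b) ≡ b
xor-cancelˡ a b = trans (sym (xor-assoc a a b)) (cong (_xor b) (xor-same a))

xor-interchange : ∀ a b c d → (a xor b) xor (c xor d) ≡ (a xor c) xor (b xor d)
xor-interchange a b c d = trans (xor-assoc a b (c xor d)) (trans (cong (a xor_) (xor-swap b c d)) (sym (xor-assoc a c (b xor d))))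

-- Chains over F₂ are lists of simplices (lists of vertices); a cochain φ is
-- evaluated on a chain by `ev`, and δ φ sums φ over the facets of a simplex.
-- The empty simplex is a facet of every vertex.

module _ {A : Set} where

  ev : (A → Bool) → List A → Bool
  ev φ []       = false
  ev φ (σ ∷ z) = φ σ xor ev φ z

  ev-++ : ∀ φ y z → ev φ (y ++ z) ≡ ev φ y xor ev φ z
  ev-++ φ []      z = refl
  ev-++ φ (σ ∷ y) z = trans (cong (φ σ xor_) (ev-++ φ y z)) (sym (xor-assoc (φ σ) (ev φ y) (ev φ z)))

  ev-cong : ∀ {φ ψ} z → (∀ {σ} → σ ∈ z → φ σ ≡ ψ σ) → ev φ z ≡ ev ψ z
  ev-cong []      eq = refl
  ev-cong (σ ∷ z) eq = cong₂ _xor_ (eq (here refl)) (ev-cong z (eq ∘ there))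

  ev-xor : ∀ φ ψ z → ev (λ σ → φ σ xor ψ σ) z ≡ ev φ z xor ev ψ z
  ev-xor φ ψ []      = refl
  ev-xor φ ψ (σ ∷ z) = trans (cong ((φ σ xor ψ σ) xor_) (ev-xor φ ψ z)) (xor-interchange (φ σ) (ψ σ) (ev φ z) (ev ψ z))

  ev-zero : ∀ z → ev (λ _ → false) z ≡ false
  ev-zero []      = refl
  ev-zero (_ ∷ z) = ev-zero z

ev-map : ∀ {A B : Set} φ (f : B → A) z → ev φ (map f z) ≡ ev (φ ∘ f) z
ev-map φ f []      = refl
ev-map φ f (x ∷ z) = cong (φ (f x) xor_) (ev-map φ f z)

ev-concatMap : ∀ {A B : Set} φ (f : B → List A) z → ev φ (concatMap f z) ≡ ev (ev φ ∘ f) z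
ev-concatMap φ f []      = refl
ev-concatMap φ f (x ∷ z) = trans (ev-++ φ (f x) (concatMap f z)) (cong (ev φ (f x) xor_) (ev-concatMap φ f z))

module _ {A : Set} where

  δ : (List A → Bool) → List A → Bool
  δ φ []      = false
  δ φ (x ∷ σ) = φ σ xor δ (φ ∘ (x ∷_)) σ

  δ-cong : ∀ {φ ψ} → (∀ σ → φ σ ≡ ψ σ) → ∀ σ → δ φ σ ≡ δ ψ σ
  δ-cong eq []      = refl
  δ-cong eq (x ∷ σ) = cong₂ _xor_ (eq σ) (δ-cong (eq ∘ (x ∷_)) σ)

  δ-xor : ∀ φ ψ σ → δ (λ τ → φ τ xor ψ τ) σ ≡ δ φ σ xor δ ψ σ
  δ-xor φ ψ []      = refl
  δ-xor φ ψ (x ∷ σ) = trans (cong ((φ σ xor ψ σ) xor_) (δ-xor (φ ∘ (x ∷_)) (ψ ∘ (x ∷_)) σ)) (xor-interchange (φ σ) (ψ σ) _ _)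

  δ-zero : ∀ σ → δ (λ _ → false) σ ≡ false
  δ-zero []      = refl
  δ-zero (x ∷ σ) = δ-zero σ

  δ-∧ : ∀ b φ σ → δ (λ τ → b ∧ φ τ) σ ≡ b ∧ δ φ σ
  δ-∧ false φ σ = δ-zero σ
  δ-∧ true  φ σ = refl

  -- Boundaries are tested against all cochains. Lists that differ by order or by cancelling pairs
  -- then behave alike, and chains need no normal form.
  Cycle : List (List A) → Set
  Cycle z = ∀ φ → ev (δ φ) z ≡ false

  _Bounds_ : List (List A) → List (List A) → Set
  h Bounds z = ∀ φ → ev (δ φ) h ≡ ev φ z

  cone : A → List (List A) → List (List A)
  cone c = map (c ∷_)

  -- The facets of c ∷ σ are σ and the cones over the facets of σ; summed over a cycle, the latter
  -- cancel.
  cone-bounds : ∀ c z → Cycle z → cone c z Bounds z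
  cone-bounds c z cyc φ = begin
    ev (δ φ) (map (c ∷_) z)                   ≡⟨ ev-map (δ φ) (c ∷_) z ⟩
    ev (λ σ → φ σ xor δ (φ ∘ (c ∷_)) σ) z     ≡⟨ ev-xor φ _ z ⟩
    ev φ z xor ev (δ (φ ∘ (c ∷_))) z          ≡⟨ cong (ev φ z xor_) (cyc _) ⟩
    ev φ z xor false                          ≡⟨ xor-identityʳ _ ⟩
    ev φ z                                    ∎
    where open ≡-Reasoning

  -- The standard triangulation of σ × [0,1]: for σ = x₀ ... xₙ, the simplices x₀ ... xᵢ (g xᵢ) ...
  -- (g xₙ).
  prism : (A → A) → List A → List (List A)
  prism g []      = []
  prism g (x ∷ σ) = (x ∷ g x ∷ map g σ) ∷ map (x ∷_) (prism g σ)

δ-map : ∀ {A B : Set} (f : A → B) φ σ → δ φ (map f σ) ≡ δ (φ ∘ map f) σ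
δ-map f φ []      = refl
δ-map f φ (x ∷ σ) = cong (φ (map f σ) xor_) (δ-map f (φ ∘ (f x ∷_)) σ)

module _ {A : Set} where

  -- The homotopy formula ∂P + P∂ = g + id, evaluated on a cochain. By induction on σ: the terms `c`
  -- and `e` occur twice, and what remains is the formula for φ ∘ (x ∷_).
  prism-boundary : ∀ (g : A → A) φ σ →
    ev (δ φ) (prism g σ) xor δ (ev φ ∘ prism g) σ ≡ φ (map g σ) xor φ σ
  prism-boundary g φ [] = sym (xor-same (φ []))
  prism-boundary g φ (x ∷ σ) = begin
    ((a xor (b xor c)) xor ev (δ φ) (map (x ∷_) P)) xor (e xor δ (ev φ ∘ prism g ∘ (x ∷_)) σ)
      ≡⟨ cong₂ (λ s t → ((a xor (b xor c)) xor s) xor (e xor t)) l₁ l₂ ⟩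
    ((a xor (b xor c)) xor (e xor p)) xor (e xor (c xor q))
      ≡⟨ rearrange a b c e p q ⟩
    a xor (b xor (p xor q))
      ≡⟨ cong (λ t → a xor (b xor t)) (prism-boundary g (φ ∘ (x ∷_)) σ) ⟩
    a xor (b xor (b xor d))
      ≡⟨ cong (a xor_) (xor-cancelˡ b d) ⟩
    a xor d ∎
    where
    open ≡-Reasoning
    P = prism g σ
    a = φ (g x ∷ map g σ)
    b = φ (x ∷ map g σ)
    c = δ (φ ∘ (x ∷_) ∘ (g x ∷_)) (map g σ)
    d = φ (x ∷ σ)
    e = ev φ P
    p = ev (δ (φ ∘ (x ∷_))) P
    q = δ (ev (φ ∘ (x ∷_)) ∘ prism g) σ
    l₁ : ev (δ φ) (map (x ∷_) P) ≡ e xor p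
    l₁ = trans (ev-map (δ φ) (x ∷_) P) (ev-xor φ (δ (φ ∘ (x ∷_))) P)
    l₂ : δ (ev φ ∘ prism g ∘ (x ∷_)) σ ≡ c xor q
    l₂ = trans (δ-xor (λ τ → φ (x ∷ g x ∷ map g τ)) (λ τ → ev φ (map (x ∷_) (prism g τ))) σ)
               (cong₂ _xor_ (sym (δ-map g (φ ∘ (x ∷_) ∘ (g x ∷_)) σ))
                            (δ-cong (λ τ → ev-map φ (x ∷_) (prism g τ)) σ))
    rearrange : ∀ a b c e p q → ((a xor (b xor c)) xor (e xor p)) xor (e xor (c xor q)) ≡ a xor (b xor (p xor q))
    rearrange a b c e p q = begin
      ((a xor (b xor c)) xor (e xor p)) xor (e xor (c xor q)) ≡⟨ xor-assoc (a xor (b xor c)) (e xor p) _ ⟩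
      (a xor (b xor c)) xor ((e xor p) xor (e xor (c xor q))) ≡⟨ cong ((a xor (b xor c)) xor_) (xor-interchange e p e (c xor q)) ⟩
      (a xor (b xor c)) xor ((e xor e) xor (p xor (c xor q))) ≡⟨ cong (λ t → (a xor (b xor c)) xor (t xor (p xor (c xor q)))) (xor-same e) ⟩
      (a xor (b xor c)) xor (p xor (c xor q))                 ≡⟨ xor-assoc a (b xor c) _ ⟩
      a xor ((b xor c) xor (p xor (c xor q)))                 ≡⟨ cong (λ t → a xor ((b xor c) xor t)) (xor-swap p c q) ⟩
      a xor ((b xor c) xor (c xor (p xor q)))                 ≡⟨ cong (a xor_) (xor-assoc b c _) ⟩
      a xor (b xor (c xor (c xor (p xor q))))                 ≡⟨ cong (λ t → a xor (b xor t)) (xor-cancelˡ c (p xor q)) ⟩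
      a xor (b xor (p xor q)) ∎

  Cycle-map : ∀ (g : A → A) z → Cycle z → Cycle (map (map g) z)
  Cycle-map g z cyc φ = trans (ev-map (δ φ) (map g) z) (trans (ev-cong z (λ {σ} _ → δ-map g φ σ)) (cyc (φ ∘ map g)))

  -- On a cycle the term P∂ vanishes, so the prism bounds z together with its image, and h removes
  -- the image.
  prism-bounds : ∀ (g : A → A) z h → Cycle z → h Bounds map (map g) z → (concatMap (prism g) z ++ h) Bounds z
  prism-bounds g z h cyc hb φ = begin
    ev (δ φ) (concatMap (prism g) z ++ h)          ≡⟨ ev-++ (δ φ) (concatMap (prism g) z) h ⟩
    ev (δ φ) (concatMap (prism g) z) xor ev (δ φ) h ≡⟨ cong₂ _xor_ (ev-concatMap (δ φ) (prism g) z) (trans (hb φ) (ev-map φ (map g) z)) ⟩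
    p xor ev (φ ∘ map g) z                          ≡⟨ cong (_xor ev (φ ∘ map g) z) (sym (xor-identityʳ p)) ⟩
    (p xor false) xor ev (φ ∘ map g) z              ≡⟨ cong (λ t → (p xor t) xor ev (φ ∘ map g) z) (sym (cyc (ev φ ∘ prism g))) ⟩
    (p xor ev (δ (ev φ ∘ prism g)) z) xor ev (φ ∘ map g) z
      ≡⟨ cong (_xor ev (φ ∘ map g) z) (sym (ev-xor (ev (δ φ) ∘ prism g) (δ (ev φ ∘ prism g)) z)) ⟩
    ev (λ σ → ev (δ φ) (prism g σ) xor δ (ev φ ∘ prism g) σ) z xor ev (φ ∘ map g) z
      ≡⟨ cong (_xor ev (φ ∘ map g) z) (trans (ev-cong z (λ {σ} _ → prism-boundary g φ σ)) (ev-xor (φ ∘ map g) φ z)) ⟩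
    (r xor ev φ z) xor r                            ≡⟨ cong (_xor r) (xor-comm r (ev φ z)) ⟩
    (ev φ z xor r) xor r                            ≡⟨ xor-assoc (ev φ z) r r ⟩
    ev φ z xor (r xor r)                            ≡⟨ cong (ev φ z xor_) (xor-same r) ⟩
    ev φ z xor false                                ≡⟨ xor-identityʳ _ ⟩
    ev φ z ∎
    where
    open ≡-Reasoning
    p = ev (ev (δ φ) ∘ prism g) z
    r = ev (φ ∘ map g) z

  prism-vertex : ∀ (g : A → A) σ {τ x} → τ ∈ prism g σ → x ∈ τ → x ∈ σ ⊎ ∃ λ y → y ∈ σ × x ≡ g y
  prism-vertex g (y ∷ σ) (here refl) (here x≡y)              = inj₁ (here x≡y)
  prism-vertex g (y ∷ σ) (here refl) (there (here x≡gy))     = inj₂ (y , here refl , x≡gy)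
  prism-vertex g (y ∷ σ) (here refl) (there (there x∈gσ))
    with ∈-map⁻ g x∈gσ
  ... | y′ , y′∈σ , x≡gy′ = inj₂ (y′ , there y′∈σ , x≡gy′)
  prism-vertex g (y ∷ σ) (there τ∈) x∈τ with ∈-map⁻ (y ∷_) τ∈
  prism-vertex g (y ∷ σ) (there τ∈) (here x≡y)  | τ′ , τ′∈ , refl = inj₁ (here x≡y)
  prism-vertex g (y ∷ σ) (there τ∈) (there x∈τ) | τ′ , τ′∈ , refl with prism-vertex g σ τ′∈ x∈τ
  ... | inj₁ x∈σ                = inj₁ (there x∈σ)
  ... | inj₂ (y′ , y′∈σ , x≡gy′) = inj₂ (y′ , there y′∈σ , x≡gy′)

  prism-length : ∀ (g : A → A) σ {τ} → τ ∈ prism g σ → length τ ≡ suc (length σ)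
  prism-length g (y ∷ σ) (here refl) = cong (λ n → suc (suc n)) (length-map g σ)
  prism-length g (y ∷ σ) (there τ∈) with ∈-map⁻ (y ∷_) τ∈
  ... | τ′ , τ′∈ , refl = cong suc (prism-length g σ τ′∈)

-- Signed labels and alternating simplices

Label : ℕ → Set
Label zero    = ⊥
Label (suc n) = Bool ⊎ Label n

neg : ∀ {n} → Label n → Label n
neg {suc n} (inj₁ s) = inj₁ (not s)
neg {suc n} (inj₂ a) = inj₂ (neg a)

module _ {B : Set} where

  tops : List (Bool ⊎ B) → List Bool
  tops []           = []
  tops (inj₁ s ∷ σ) = s ∷ tops σ
  tops (inj₂ _ ∷ σ) = tops σ

  rests : List (Bool ⊎ B) → List B
  rests []           = []
  rests (inj₁ _ ∷ σ) = rests σ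
  rests (inj₂ a ∷ σ) = a ∷ rests σ

  ∈-tops : ∀ {s} σ → s ∈ tops σ → inj₁ s ∈ σ
  ∈-tops (inj₁ _ ∷ σ) (here refl) = here refl
  ∈-tops (inj₁ _ ∷ σ) (there s∈)  = there (∈-tops σ s∈)
  ∈-tops (inj₂ _ ∷ σ) s∈          = there (∈-tops σ s∈)

  ∈-rests : ∀ {a} σ → a ∈ rests σ → inj₂ a ∈ σ
  ∈-rests (inj₁ _ ∷ σ) a∈          = there (∈-rests σ a∈)
  ∈-rests (inj₂ _ ∷ σ) (here refl) = here refl
  ∈-rests (inj₂ _ ∷ σ) (there a∈)  = there (∈-rests σ a∈)

  length-split : ∀ σ → length σ ≡ length (tops σ) + length (rests σ)
  length-split []           = refl
  length-split (inj₁ _ ∷ σ) = cong suc (length-split σ)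
  length-split (inj₂ _ ∷ σ) = trans (cong suc (length-split σ)) (sym (+-suc _ _))

  -- A Leibniz rule: the vertex left out of σ is either one of the outermost absolute value or one
  -- of the others.
  δ-split : ∀ (G : List Bool → List B → Bool) σ →
    δ (λ τ → G (tops τ) (rests τ)) σ ≡ δ (λ a → G a (rests σ)) (tops σ) xor δ (G (tops σ)) (rests σ)
  δ-split G []           = refl
  δ-split G (inj₁ s ∷ σ) =
    trans (cong (G (tops σ) (rests σ) xor_) (δ-split (λ a → G (s ∷ a)) σ))
          (sym (xor-assoc (G (tops σ) (rests σ)) _ _))
  δ-split G (inj₂ y ∷ σ) =
    trans (cong (G (tops σ) (rests σ) xor_) (δ-split (λ a b → G a (y ∷ b)) σ))
          (xor-swap (G (tops σ) (rests σ)) (δ (λ a → G a (y ∷ rests σ)) (tops σ)) _)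

_==_ : Bool → Bool → Bool
true  == s = s
false == s = not s

-- alt n s σ holds iff the labels in σ have distinct absolute values and
-- alternating signs, the sign of the label of outermost absolute value being s.

alt    : ∀ n → Bool → List (Label n) → Bool
altTop : ∀ n → Bool → List Bool → List (Label n) → Bool

alt zero    s σ = true
alt (suc n) s σ = altTop n s (tops σ) (rests σ)

altTop n s []          ρ = alt n s ρ
altTop n s (t ∷ [])    ρ = (t == s) ∧ alt n (not s) ρ
altTop n s (_ ∷ _ ∷ _) ρ = false

alt-length : ∀ n s σ → alt n s σ ≡ true → length σ ≤ n
alt-length zero    s []  eq = z≤n
alt-length (suc n) s σ eq with tops σ | length-split σ
... | []         | len = m≤n⇒m≤1+n (≤-trans (≤-reflexive len) (alt-length n s (rests σ) eq))
... | t ∷ []     | len with t == s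
... | true = ≤-trans (≤-reflexive len) (s≤s (alt-length n (not s) (rests σ) eq))

alt-neg : ∀ n s σ → alt n s (map neg σ) ≡ alt n (not s) σ
alt-neg zero    s σ = refl
alt-neg (suc n) s σ = trans (cong₂ (altTop n s) (tops-neg σ) (rests-neg σ)) (top (tops σ))
  where
  tops-neg : ∀ σ → tops (map neg σ) ≡ map not (tops {Label n} σ)
  tops-neg []           = refl
  tops-neg (inj₁ s ∷ σ) = cong (not s ∷_) (tops-neg σ)
  tops-neg (inj₂ _ ∷ σ) = tops-neg σ
  rests-neg : ∀ σ → rests (map neg σ) ≡ map neg (rests {Label n} σ)
  rests-neg []           = refl
  rests-neg (inj₁ s ∷ σ) = rests-neg σ
  rests-neg (inj₂ a ∷ σ) = cong (neg a ∷_) (rests-neg σ)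
  ==-not : ∀ t s → (not t == s) ≡ (t == not s)
  ==-not true  s     = refl
  ==-not false true  = refl
  ==-not false false = refl
  top : ∀ ts → altTop n s (map not ts) (map neg (rests σ)) ≡ altTop n (not s) ts (rests σ)
  top []          = alt-neg n s (rests σ)
  top (t ∷ [])    = cong₂ _∧_ (==-not t s) (alt-neg n (not s) (rests σ))
  top (_ ∷ _ ∷ _) = refl

alt-[] : ∀ n s → alt n s [] ≡ true
alt-[] zero    s = refl
alt-[] (suc n) s = alt-[] n s

-- A single label alternates with exactly one leading sign, so the count in Fan's argument starts
-- odd.
alt-singleton : ∀ n (a : Label n) → alt n true (a ∷ []) xor alt n false (a ∷ []) ≡ true
alt-singleton (suc n) (inj₂ a)     = alt-singleton n a
alt-singleton (suc n) (inj₁ true)  = cong (_xor false) (alt-[] n false)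
alt-singleton (suc n) (inj₁ false) = alt-[] n true

NoComplementary : ∀ {n} → List (Label n) → Set
NoComplementary σ = ∀ {a} → a ∈ σ → neg a ∉ σ

-- Induction on the absolute values, according to how many labels have the outermost one. With none,
-- the claim is that for the rest. With one, leaving it out gives the rest with sign s, and keeping
-- it leads to the induction hypothesis. Two equal labels give equal facets, which cancel; two
-- opposite ones are excluded; with three or more no facet alternates.
δ-alt : ∀ n s σ → NoComplementary σ → δ (alt n s) σ ≡ alt n true σ xor alt n false σ
δ-alt zero    s []  nc = refl
δ-alt (suc n) s σ   nc = trans (δ-split (altTop n s) σ) (go (tops σ) (λ t∈ t′∈ → nc (∈-tops σ t∈) (∈-tops σ t′∈)))
  where
  ρ = rests σ
  ih : ∀ s → δ (alt n s) ρ ≡ alt n true ρ xor alt n false ρ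
  ih s = δ-alt n s ρ (λ a∈ a′∈ → nc (∈-rests σ a∈) (∈-rests σ a′∈))
  go : ∀ ts → (∀ {t} → t ∈ ts → not t ∉ ts) →
    δ (λ a → altTop n s a ρ) ts xor δ (altTop n s ts) ρ ≡ altTop n true ts ρ xor altTop n false ts ρ
  go [] nc = ih s
  go (t ∷ []) nc =
    trans (cong₂ _xor_ (xor-identityʳ (alt n s ρ)) (trans (δ-∧ (t == s) (alt n (not s)) ρ) (cong ((t == s) ∧_) (ih (not s)))))
          (cases t s)
    where
    cases : ∀ t s → alt n s ρ xor ((t == s) ∧ (alt n true ρ xor alt n false ρ))
      ≡ ((t == true) ∧ alt n false ρ) xor ((t == false) ∧ alt n true ρ)
    cases true  true  = trans (xor-cancelˡ (alt n true ρ) (alt n false ρ)) (sym (xor-identityʳ (alt n false ρ)))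
    cases true  false = refl
    cases false true  = xor-identityʳ _
    cases false false = trans (cong (alt n false ρ xor_) (xor-comm (alt n true ρ) (alt n false ρ))) (xor-cancelˡ (alt n false ρ) (alt n true ρ))
  go (true  ∷ false ∷ ts)  nc = ⊥-elim (nc (here refl) (there (here refl)))
  go (false ∷ true  ∷ ts)  nc = ⊥-elim (nc (here refl) (there (here refl)))
  go (true  ∷ true  ∷ [])  nc = cong₂ _xor_ (trans (cong (((true == s) ∧ alt n (not s) ρ) xor_) (xor-identityʳ _)) (xor-same ((true == s) ∧ alt n (not s) ρ))) (δ-zero ρ)
  go (false ∷ false ∷ [])  nc = cong₂ _xor_ (trans (cong (((false == s) ∧ alt n (not s) ρ) xor_) (xor-identityʳ _)) (xor-same ((false == s) ∧ alt n (not s) ρ))) (δ-zero ρ)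
  go (t ∷ t′ ∷ t″ ∷ ts) nc = cong₂ _xor_ (δ-zero ts) (δ-zero ρ)

-- Filling cycles in the grid sphere

module Chains {A : Set} (adj : A → A → Set) where

  -- Simplices of the clique complex of `adj` with d vertices, repetitions allowed.
  Chain : (A → Set) → ℕ → List (List A) → Set
  Chain S d z = ∀ {σ} → σ ∈ z →
    length σ ≡ d × (∀ {x} → x ∈ σ → S x) × (∀ {x y} → x ∈ σ → y ∈ σ → adj x y)

  Chain-++ : ∀ {S d} y {z} → Chain S d y → Chain S d z → Chain S d (y ++ z)
  Chain-++ y cy cz σ∈ with ∈-++⁻ y σ∈
  ... | inj₁ σ∈y = cy σ∈y
  ... | inj₂ σ∈z = cz σ∈z

  Chain-⊆ : ∀ {S T d z} → (∀ {x} → S x → T x) → Chain S d z → Chain T d z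
  Chain-⊆ S⊆T cz σ∈ with len , S-σ , adj-σ ← cz σ∈ = len , S⊆T ∘ S-σ , adj-σ

  Chain-map : ∀ {S T d z} (g : A → A) → (∀ {x} → S x → T (g x)) →
    (∀ {x y} → S x → S y → adj x y → adj (g x) (g y)) → Chain S d z → Chain T d (map (map g) z)
  Chain-map {S} {T} g gT gadj cz σ∈ with ∈-map⁻ (map g) σ∈
  ... | σ , σ∈z , refl with cz σ∈z
  ... | len , S-σ , adj-σ = trans (length-map g σ) len , inT , inAdj
    where
    inT : ∀ {x} → x ∈ map g σ → T x
    inT x∈ with ∈-map⁻ g x∈
    ... | y , y∈ , refl = gT (S-σ y∈)
    inAdj : ∀ {x y} → x ∈ map g σ → y ∈ map g σ → adj x y
    inAdj x∈ y∈ with ∈-map⁻ g x∈ | ∈-map⁻ g y∈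
    ... | x , x∈σ , refl | y , y∈σ , refl = gadj (S-σ x∈σ) (S-σ y∈σ) (adj-σ x∈σ y∈σ)

  Chain-cone : ∀ {S T d z} c → T c → adj c c → (∀ {x} → S x → T x × adj c x × adj x c) →
    Chain S d z → Chain T (suc d) (cone c z)
  Chain-cone {S} {T} c Tc cc cS cz σ∈ with ∈-map⁻ (c ∷_) σ∈
  ... | σ , σ∈z , refl with cz σ∈z
  ... | len , S-σ , adj-σ = cong suc len , inT , inAdj
    where
    inT : ∀ {x} → x ∈ c ∷ σ → T x
    inT (here refl) = Tc
    inT (there x∈)  = proj₁ (cS (S-σ x∈))
    inAdj : ∀ {x y} → x ∈ c ∷ σ → y ∈ c ∷ σ → adj x y
    inAdj (here refl) (here refl) = cc
    inAdj (here refl) (there y∈)  = proj₁ (proj₂ (cS (S-σ y∈)))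
    inAdj (there x∈)  (here refl) = proj₂ (proj₂ (cS (S-σ x∈)))
    inAdj (there x∈)  (there y∈)  = adj-σ x∈ y∈

  Chain-prism : ∀ {S T d z} (g : A → A) → (∀ {x} → S x → T x × T (g x)) →
    (∀ {x y} → S x → S y → adj x y → adj x (g y) × adj (g x) y × adj (g x) (g y)) →
    Chain S d z → Chain T (suc d) (concatMap (prism g) z)
  Chain-prism {S} {T} g gT gadj cz {τ} τ∈ with ∈-concatMap⁻′ τ∈
    where
    ∈-concatMap⁻′ : ∀ {z τ} → τ ∈ concatMap (prism g) z → ∃ λ σ → σ ∈ z × τ ∈ prism g σ
    ∈-concatMap⁻′ {σ ∷ z} τ∈ with ∈-++⁻ (prism g σ) τ∈
    ... | inj₁ τ∈σ = σ , here refl , τ∈σ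
    ... | inj₂ τ∈z with σ′ , σ′∈ , τ∈′ ← ∈-concatMap⁻′ τ∈z = σ′ , there σ′∈ , τ∈′
  ... | σ , σ∈z , τ∈σ with cz σ∈z
  ... | len , S-σ , adj-σ = trans (prism-length g σ τ∈σ) (cong suc len) , inT , inAdj
    where
    inT : ∀ {x} → x ∈ τ → T x
    inT x∈ with prism-vertex g σ τ∈σ x∈
    ... | inj₁ x∈σ              = proj₁ (gT (S-σ x∈σ))
    ... | inj₂ (y , y∈σ , refl) = proj₂ (gT (S-σ y∈σ))
    inAdj : ∀ {x y} → x ∈ τ → y ∈ τ → adj x y
    inAdj x∈ y∈ with prism-vertex g σ τ∈σ x∈ | prism-vertex g σ τ∈σ y∈
    ... | inj₁ x∈σ | inj₁ y∈σ = adj-σ x∈σ y∈σ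
    ... | inj₁ x∈σ | inj₂ (y , y∈σ , refl) = proj₁ (gadj (S-σ x∈σ) (S-σ y∈σ) (adj-σ x∈σ y∈σ))
    ... | inj₂ (x , x∈σ , refl) | inj₁ y∈σ = proj₁ (proj₂ (gadj (S-σ x∈σ) (S-σ y∈σ) (adj-σ x∈σ y∈σ)))
    ... | inj₂ (x , x∈σ , refl) | inj₂ (y , y∈σ , refl) = proj₂ (proj₂ (gadj (S-σ x∈σ) (S-σ y∈σ) (adj-σ x∈σ y∈σ)))

  Fills : (A → Set) → ℕ → List (List A) → Set
  Fills T d z = ∃ λ h → h Bounds z × Chain T (suc d) h

  -- The prism slides the cycle along g inside T and leaves only its image to be filled.
  fill-along : ∀ {S S′ T d z} (g : A → A) → (∀ {x} → S x → T x × T (g x)) → (∀ {x} → S x → S′ (g x)) →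
    (∀ {x y} → S x → S y → adj x y → adj x (g y) × adj (g x) y × adj (g x) (g y)) →
    Cycle z → Chain S d z →
    (∀ z′ → Cycle z′ → Chain S′ d z′ → Fills T d z′) → Fills T d z
  fill-along {z = z} g gT gS gadj cyc cz fill
    with h , hb , ch ← fill (map (map g) z) (Cycle-map g z cyc) (Chain-map g gS (λ sx sy a → proj₂ (proj₂ (gadj sx sy a))) cz)
    = concatMap (prism g) z ++ h , prism-bounds g z h cyc hb , Chain-++ (concatMap (prism g) z) (Chain-prism g gT gadj cz) ch

-- A grid point has coordinates (a , b) with a + b = 2k, so that the antipode
-- is coordinatewise swap and an involution on the nose.

module Grid (m k : ℕ) where

  Pt : Set
  Pt = Fin m → ℕ × ℕ

  ν : Pt → Pt
  ν x = swap ∘ x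

  close : ℕ → ℕ → Set
  close a a′ = a ≤ suc a′ × a′ ≤ suc a

  adj : Pt → Pt → Set
  adj x y = ∀ i → close (proj₁ (x i)) (proj₁ (y i))

  close-refl : ∀ {a} → close a a
  close-refl = n≤1+n _ , n≤1+n _

  Balanced : Pt → Set
  Balanced x = ∀ i → proj₁ (x i) + proj₂ (x i) ≡ k + k

  -- A (j - 2)-sphere: only the first j coordinates vary, and among them both extremes are attained.
  -- It lies as an equator in the sphere for j + 1.
  record Good (j : ℕ) (x : Pt) : Set where
    constructor good
    field
      bal : Balanced x
      mid : ∀ i → j ≤ toℕ i → x i ≡ (k , k)
      bot : ∃ λ i → toℕ i < j × proj₁ (x i) ≡ 0
      top : ∃ λ i → toℕ i < j × proj₂ (x i) ≡ 0
  open Good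

  Good-ν : ∀ {j x} → Good j x → Good j (ν x)
  Good-ν {x = x} g = good (λ i → trans (+-comm (proj₂ (x i)) _) (bal g i)) (λ i j≤i → cong swap (mid g i j≤i)) (top g) (bot g)

  close-snd : ∀ {a b a′ b′ L} → a + b ≡ L → a′ + b′ ≡ L → close a a′ → close b b′
  close-snd {a} {b} {a′} {b′} p q (u , v) = half p q v , half q p u
    where
    half : ∀ {a b a′ b′ L} → a + b ≡ L → a′ + b′ ≡ L → a′ ≤ suc a → b ≤ suc b′
    half {a} {b} {a′} {b′} p q le = +-cancelˡ-≤ a b (suc b′) (begin
      a + b       ≡⟨ trans p (sym q) ⟩
      a′ + b′     ≤⟨ +-monoˡ-≤ b′ le ⟩
      suc a + b′  ≡⟨ sym (+-suc a b′) ⟩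
      a + suc b′  ∎)
      where open ≤-Reasoning

  adj-ν : ∀ {x y} → Balanced x → Balanced y → adj x y → adj (ν x) (ν y)
  adj-ν bx by a i = close-snd (bx i) (by i) (a i)

  open Chains adj

  module Filling (J : Fin m) where

    j : ℕ
    j = toℕ J

    update : (ℕ × ℕ → ℕ × ℕ) → (ℕ × ℕ → ℕ × ℕ) → Pt → Pt
    update f g x i with <-cmp (toℕ i) j
    ... | tri< _ _ _ = f (x i)
    ... | tri≈ _ _ _ = g (x i)
    ... | tri> _ _ _ = x i

    -- Second stage of the filling. Coordinate J is now at the maximum, so the earlier ones may
    -- leave theirs and be pushed down to 0 one level at a time.
    record Lowered (t : ℕ) (x : Pt) : Set where
      constructor lowered
      field
        lbal : Balanced x
        lmid : ∀ i → j < toℕ i → x i ≡ (k , k)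
        ltop : x J ≡ (k + k , 0)
        lbot : ∃ λ i → toℕ i < j × proj₁ (x i) ≡ 0
        lcap : ∀ i → toℕ i < j → proj₁ (x i) ≤ t
    open Lowered

    Lowered⇒Good : ∀ {t x} → Lowered t x → Good (suc j) x
    Lowered⇒Good (lowered bl md tp (i , i<j , z) cp) =
      good bl md (i , m≤n⇒m≤1+n i<j , z) (J , ≤-refl , cong proj₂ tp)


    -- Meant for a ≤ suc t: the second case is then a = suc t, and the sum of the pair is kept.
    cut : ℕ → ℕ × ℕ → ℕ × ℕ
    cut t (a , b) with a ≤? t
    ... | yes _ = a , b
    ... | no  _ = t , suc b

    cut-balanced : ∀ {t a b L} → a ≤ suc t → a + b ≡ L → proj₁ (cut t (a , b)) + proj₂ (cut t (a , b)) ≡ L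
    cut-balanced {t} {a} {b} a≤ eq with a ≤? t
    ... | yes _  = eq
    ... | no a≰t with refl ← ≤-antisym a≤ (≰⇒> a≰t) = trans (+-suc t b) eq

    cut-zero : ∀ {t p} → proj₁ p ≡ 0 → proj₁ (cut t p) ≡ 0
    cut-zero {t} {a , b} eq with a ≤? t
    ... | yes _  = eq
    ... | no a≰t = ⊥-elim (a≰t (subst (_≤ t) (sym eq) z≤n))

    cut-cap : ∀ t p → proj₁ (cut t p) ≤ t
    cut-cap t (a , b) with a ≤? t
    ... | yes a≤t = a≤t
    ... | no  _   = ≤-refl

    -- Only the value t + 1 moves, to t. Under the cap t + 1, a value close to t + 1 is t or t + 1,
    -- hence still close to t.
    cut-close : ∀ {t p q} → proj₁ p ≤ suc t → proj₁ q ≤ suc t → close (proj₁ p) (proj₁ q) →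
      close (proj₁ p) (proj₁ (cut t q)) × close (proj₁ (cut t p)) (proj₁ q) × close (proj₁ (cut t p)) (proj₁ (cut t q))
    cut-close {t} {a , _} {a′ , _} p≤ q≤ (u , v) with a ≤? t | a′ ≤? t
    ... | yes a≤ | yes a′≤ = (u , v) , (u , v) , (u , v)
    ... | yes a≤ | no a′≰ with refl ← ≤-antisym q≤ (≰⇒> a′≰) = below , (u , v) , below
      where below = m≤n⇒m≤1+n a≤ , ≤-trans (≤-pred v) (n≤1+n _)
    cut-close {t} {a , _} {a′ , _} p≤ q≤ (u , v) | no a≰ | yes a′≤ with refl ← ≤-antisym p≤ (≰⇒> a≰) = (u , v) , below , below
      where below = ≤-trans (≤-pred u) (n≤1+n _) , m≤n⇒m≤1+n a′≤
    cut-close {t} {a , _} {a′ , _} p≤ q≤ (u , v) | no a≰ | no a′≰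
      with refl ← ≤-antisym p≤ (≰⇒> a≰) | refl ← ≤-antisym q≤ (≰⇒> a′≰)
      = (≤-refl , ≤-trans (n≤1+n _) (n≤1+n _)) , (≤-trans (n≤1+n _) (n≤1+n _) , ≤-refl) , close-refl

    lower : ℕ → Pt → Pt
    lower t = update (cut t) (λ p → p)

    lower-Lowered : ∀ {t x} → Lowered (suc t) x → Lowered t (lower t x)
    lower-Lowered {t} {x} (lowered bl md tp (i₀ , i₀<j , z) cp) = lowered bal′ mid′ top′ (i₀ , i₀<j , bot′) cap′
      where
      bal′ : Balanced (lower t x)
      bal′ i with <-cmp (toℕ i) j
      ... | tri< i<j _ _ = cut-balanced (cp i i<j) (bl i)
      ... | tri≈ _ _ _   = bl i
      ... | tri> _ _ _   = bl i
      mid′ : ∀ i → j < toℕ i → lower t x i ≡ (k , k)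
      mid′ i j<i with <-cmp (toℕ i) j
      ... | tri< _ _ j≯i = ⊥-elim (j≯i j<i)
      ... | tri≈ _ _ j≯i = ⊥-elim (j≯i j<i)
      ... | tri> _ _ _   = md i j<i
      top′ : lower t x J ≡ (k + k , 0)
      top′ with <-cmp (toℕ J) j
      ... | tri< _ j≢j _ = ⊥-elim (j≢j refl)
      ... | tri≈ _ _ _   = tp
      ... | tri> _ j≢j _ = ⊥-elim (j≢j refl)
      bot′ : proj₁ (lower t x i₀) ≡ 0
      bot′ with <-cmp (toℕ i₀) j
      ... | tri< _ _ _   = cut-zero {t} {x i₀} z
      ... | tri≈ _ _ _   = z
      ... | tri> _ _ _   = z
      cap′ : ∀ i → toℕ i < j → proj₁ (lower t x i) ≤ t
      cap′ i i<j with <-cmp (toℕ i) j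
      ... | tri< _ _ _     = cut-cap t (x i)
      ... | tri≈ i≮j _ _   = ⊥-elim (i≮j i<j)
      ... | tri> i≮j _ _   = ⊥-elim (i≮j i<j)

    lower-adj : ∀ {t x y} → Lowered (suc t) x → Lowered (suc t) y → adj x y →
      adj x (lower t y) × adj (lower t x) y × adj (lower t x) (lower t y)
    lower-adj {t} {x} {y} lx ly a = (λ i → proj₁ (at i)) , (λ i → proj₁ (proj₂ (at i))) , (λ i → proj₂ (proj₂ (at i)))
      where
      at : ∀ i → close (proj₁ (x i)) (proj₁ (lower t y i)) × close (proj₁ (lower t x i)) (proj₁ (y i)) ×
                 close (proj₁ (lower t x i)) (proj₁ (lower t y i))
      at i with <-cmp (toℕ i) j
      ... | tri< i<j _ _ = cut-close {t} {x i} {y i} (lcap lx i i<j) (lcap ly i i<j) (a i)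
      ... | tri≈ _ _ _   = a i , a i , a i
      ... | tri> _ _ _   = a i , a i , a i

    apex : Pt
    apex i with <-cmp (toℕ i) j
    ... | tri< _ _ _ = 0 , k + k
    ... | tri≈ _ _ _ = k + k , 0
    ... | tri> _ _ _ = k , k

    apex-Good : 1 ≤ j → Good (suc j) apex
    apex-Good 1≤j = good bal′ mid′ (first , m≤n⇒m≤1+n first<j , bot′) (J , ≤-refl , top′)
      where
      first : Fin m
      first = fromℕ< (≤-trans 1≤j (<⇒≤ (toℕ<n J)))
      first<j : toℕ first < j
      first<j = subst (_< j) (sym (toℕ-fromℕ< (≤-trans 1≤j (<⇒≤ (toℕ<n J))))) 1≤j
      bal′ : Balanced apex
      bal′ i with <-cmp (toℕ i) j
      ... | tri< _ _ _ = refl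
      ... | tri≈ _ _ _ = +-identityʳ (k + k)
      ... | tri> _ _ _ = refl
      mid′ : ∀ i → j < toℕ i → apex i ≡ (k , k)
      mid′ i j<i with <-cmp (toℕ i) j
      ... | tri< _ _ j≯i = ⊥-elim (j≯i j<i)
      ... | tri≈ _ _ j≯i = ⊥-elim (j≯i j<i)
      ... | tri> _ _ _   = refl
      bot′ : proj₁ (apex first) ≡ 0
      bot′ with <-cmp (toℕ first) j
      ... | tri< _ _ _   = refl
      ... | tri≈ ≮j _ _  = ⊥-elim (≮j first<j)
      ... | tri> ≮j _ _  = ⊥-elim (≮j first<j)
      top′ : proj₂ (apex J) ≡ 0
      top′ with <-cmp (toℕ J) j
      ... | tri< _ j≢j _ = ⊥-elim (j≢j refl)
      ... | tri≈ _ _ _   = refl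
      ... | tri> _ j≢j _ = ⊥-elim (j≢j refl)

    apex-adj : ∀ {x} → Lowered 0 x → adj apex x × adj x apex
    apex-adj {x} lx = (λ i → same (at i)) , (λ i → same (sym (at i)))
      where
      same : ∀ {a b} → a ≡ b → close a b
      same refl = close-refl
      at : ∀ i → proj₁ (apex i) ≡ proj₁ (x i)
      at i with <-cmp (toℕ i) j
      ... | tri< i<j _ _ = sym (n≤0⇒n≡0 (lcap lx i i<j))
      ... | tri≈ _ i≡j _ = cong proj₁ (sym (trans (cong x (toℕ-injective i≡j)) (ltop lx)))
      ... | tri> _ _ j<i = cong proj₁ (sym (lmid lx i j<i))

    -- At cap 0 every point has the first components of `apex`, so the cone over `apex` fills.
    fill-lowered : 1 ≤ j → ∀ t {d} z → Cycle z → Chain (Lowered t) d z → Fills (Good (suc j)) d z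
    fill-lowered 1≤j zero z cyc cz =
      cone apex z , cone-bounds apex z cyc ,
      Chain-cone apex (apex-Good 1≤j) (λ _ → close-refl) (λ lx → Lowered⇒Good lx , apex-adj lx) cz
    fill-lowered 1≤j (suc t) z cyc cz =
      fill-along (lower t) (λ lx → Lowered⇒Good lx , Lowered⇒Good (lower-Lowered lx)) lower-Lowered lower-adj cyc cz (fill-lowered 1≤j t)

    -- First stage of the filling. Both extremes are attained before J, which leaves coordinate J
    -- free to climb; t is its distance from the maximum.
    record Raised (t : ℕ) (x : Pt) : Set where
      constructor raised
      field
        rgood : Balanced x
        rmid  : ∀ i → j < toℕ i → x i ≡ (k , k)
        rbot  : ∃ λ i → toℕ i < j × proj₁ (x i) ≡ 0
        rtop  : ∃ λ i → toℕ i < j × proj₂ (x i) ≡ 0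
        rrem  : proj₂ (x J) ≡ t
    open Raised

    Raised⇒Good : ∀ {t x} → Raised t x → Good (suc j) x
    Raised⇒Good (raised bl md (i , i<j , z) (i′ , i′<j , z′) _) =
      good bl md (i , m≤n⇒m≤1+n i<j , z) (i′ , m≤n⇒m≤1+n i′<j , z′)

    raise : ℕ → Pt → Pt
    raise t = update (λ p → p) (λ p → suc (proj₁ p) , t)

    raise-Raised : ∀ {t x} → Raised (suc t) x → Raised t (raise t x)
    raise-Raised {t} {x} (raised bl md (i₀ , i₀<j , z) (i₁ , i₁<j , z′) rm) =
      raised bal′ mid′ (i₀ , i₀<j , trans (cong proj₁ (same i₀ i₀<j)) z) (i₁ , i₁<j , trans (cong proj₂ (same i₁ i₁<j)) z′) rem′
      where
      same : ∀ i → toℕ i < j → raise t x i ≡ x i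
      same i i<j with <-cmp (toℕ i) j
      ... | tri< _ _ _   = refl
      ... | tri≈ i≮j _ _ = ⊥-elim (i≮j i<j)
      ... | tri> _ _ _   = refl
      bal′ : Balanced (raise t x)
      bal′ i with <-cmp (toℕ i) j
      ... | tri< _ _ _   = bl i
      ... | tri≈ _ i≡j _ with refl ← toℕ-injective i≡j = trans (sym (+-suc (proj₁ (x i)) t)) (trans (cong (proj₁ (x i) +_) (sym rm)) (bl i))
      ... | tri> _ _ _   = bl i
      mid′ : ∀ i → j < toℕ i → raise t x i ≡ (k , k)
      mid′ i j<i with <-cmp (toℕ i) j
      ... | tri< _ _ j≯i = ⊥-elim (j≯i j<i)
      ... | tri≈ _ _ j≯i = ⊥-elim (j≯i j<i)
      ... | tri> _ _ _   = md i j<i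
      rem′ : proj₂ (raise t x J) ≡ t
      rem′ with <-cmp (toℕ J) j
      ... | tri< _ j≢j _ = ⊥-elim (j≢j refl)
      ... | tri≈ _ _ _   = refl
      ... | tri> _ j≢j _ = ⊥-elim (j≢j refl)

    -- All points of a stage agree in coordinate J, so moving it by one keeps old and new points
    -- close.
    raise-adj : ∀ {t x y} → Raised (suc t) x → Raised (suc t) y → adj x y →
      adj x (raise t y) × adj (raise t x) y × adj (raise t x) (raise t y)
    raise-adj {t} {x} {y} rx ry a = (λ i → proj₁ (at i)) , (λ i → proj₁ (proj₂ (at i))) , (λ i → proj₂ (proj₂ (at i)))
      where
      eq : proj₁ (x J) ≡ proj₁ (y J)
      eq = +-cancelʳ-≡ (suc t) _ _ (trans (cong (proj₁ (x J) +_) (sym (rrem rx))) (trans (rgood rx J)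
             (sym (trans (cong (proj₁ (y J) +_) (sym (rrem ry))) (rgood ry J)))))
      at : ∀ i → close (proj₁ (x i)) (proj₁ (raise t y i)) × close (proj₁ (raise t x i)) (proj₁ (y i)) ×
                 close (proj₁ (raise t x i)) (proj₁ (raise t y i))
      at i with <-cmp (toℕ i) j
      ... | tri< _ _ _   = a i , a i , a i
      ... | tri≈ _ i≡j _ with refl ← toℕ-injective i≡j =
        subst (λ b → close (proj₁ (x i)) (suc b) × close (suc (proj₁ (x i))) b × close (suc (proj₁ (x i))) (suc b)) eq
          ((≤-trans (n≤1+n _) (n≤1+n _) , ≤-refl) , (≤-refl , ≤-trans (n≤1+n _) (n≤1+n _)) , close-refl)
      ... | tri> _ _ _   = a i , a i , a i

    fill-raised : 1 ≤ j → ∀ t {d} z → Cycle z → Chain (Raised t) d z → Fills (Good (suc j)) d z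
    -- The first cap 2k holds because each pair sums to 2k.
    fill-raised 1≤j zero z cyc cz = fill-lowered 1≤j (k + k) z cyc (Chain-⊆ done cz)
      where
      done : ∀ {x} → Raised 0 x → Lowered (k + k) x
      done {x} (raised bl md bt tp rm) = lowered bl md
        (cong₂ _,_ (trans (sym (+-identityʳ _)) (trans (cong (proj₁ (x J) +_) (sym rm)) (bl J))) rm) bt
        (λ i _ → subst (proj₁ (x i) ≤_) (bl i) (m≤m+n _ _))
    fill-raised 1≤j (suc t) z cyc cz =
      fill-along (raise t) (λ rx → Raised⇒Good rx , Raised⇒Good (raise-Raised rx)) raise-Raised raise-adj cyc cz (fill-raised 1≤j t)

    fill : 1 ≤ j → ∀ {d} z → Cycle z → Chain (Good j) d z → Fills (Good (suc j)) d z
    fill 1≤j z cyc cz = fill-raised 1≤j k z cyc (Chain-⊆ start cz)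
      where
      start : ∀ {x} → Good j x → Raised k x
      start (good bl md bt tp) = raised bl (λ i j<i → md i (<⇒≤ j<i)) bt tp (cong proj₂ (md J ≤-refl))

-- Fan's counting argument

label : ∀ {n} → Fin n → Bool → Label n
label zero    s = inj₁ s
label (suc i) s = inj₂ (label i s)

label-injective : ∀ {n} (i j : Fin n) {s t} → label i s ≡ label j t → i ≡ j × s ≡ t
label-injective zero    zero    refl = refl , refl
label-injective (suc i) (suc j) eq with refl , s≡t ← label-injective i j (inj₂-injective eq) = refl , s≡t

neg-label : ∀ {n} (i : Fin n) s → neg (label i s) ≡ label i (not s)
neg-label zero    s = refl
neg-label (suc i) s = cong inj₂ (neg-label i s)

module Colouring (m′ k : ℕ) where

  open Grid (3 + m′) k
  open Good
  open Chains adj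

  module _ (c : Pt → Fin (2 + m′))
           (proper : ∀ {x y} → Good (3 + m′) x → Good (3 + m′) y → adj x (ν y) → c x ≢ c y) where

    GoodPt : Pt → Set
    GoodPt = Good (3 + m′)

    c# : Pt → ℕ
    c# x = toℕ (c x)

    smaller : ∀ x y → c# x < c# y → Fin (1 + m′)
    smaller x y lt = fromℕ< (≤-trans lt (≤-pred (toℕ<n (c y))))

    toℕ-smaller : ∀ x y lt → toℕ (smaller x y lt) ≡ c# x
    toℕ-smaller x y lt = toℕ-fromℕ< (≤-trans lt (≤-pred (toℕ<n (c y))))

    -- The colours of x and of its antipode differ, so the smaller one is not
    -- the last colour: one label fewer than there are colours.
    lab : Pt → Label (1 + m′)
    lab x with <-cmp (c# x) (c# (ν x))
    ... | tri< lt _ _ = label (smaller x (ν x) lt) true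
    -- A placeholder: a good point and its antipode have different colours.
    ... | tri≈ _ _ _  = inj₁ true
    ... | tri> _ _ gt = label (smaller (ν x) x gt) false

    c#-antipode : ∀ {x} → GoodPt x → c# x ≢ c# (ν x)
    c#-antipode gx eq = proper gx (Good-ν gx) (λ _ → close-refl) (toℕ-injective eq)

    lab-ν : ∀ {x} → GoodPt x → lab (ν x) ≡ neg (lab x)
    lab-ν {x} gx with <-cmp (c# x) (c# (ν x)) | <-cmp (c# (ν x)) (c# x)
    ... | tri≈ _ eq _ | _           = ⊥-elim (c#-antipode gx eq)
    ... | _           | tri≈ _ eq _ = ⊥-elim (c#-antipode gx (sym eq))
    ... | tri< lt _ _ | tri< gt _ _ = ⊥-elim (<-asym lt gt)
    ... | tri> _ _ lt | tri> _ _ gt = ⊥-elim (<-asym lt gt)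
    ... | tri< lt _ _ | tri> _ _ _  = sym (neg-label (smaller x (ν x) lt) true)
    ... | tri> _ _ gt | tri< _ _ _  = sym (neg-label (smaller (ν x) x gt) false)

    -- Opposite labels with the same absolute value mean that x and νy, or νx and y, have a common
    -- colour. But `adj x y` is `adj x (ν (ν y))`, so `proper` forbids this.
    lab-complementary : ∀ {x y} → GoodPt x → GoodPt y → adj x y → lab x ≢ neg (lab y)
    lab-complementary {x} {y} gx gy a eq with <-cmp (c# x) (c# (ν x)) | <-cmp (c# y) (c# (ν y))
    ... | tri≈ _ e _ | _          = c#-antipode gx e
    ... | _          | tri≈ _ e _ = c#-antipode gy e
    ... | tri< p _ _ | tri< q _ _ with () ← proj₂ (label-injective (smaller x (ν x) p) (smaller y (ν y) q) (trans eq (neg-label _ true)))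
    ... | tri> _ _ p | tri> _ _ q with () ← proj₂ (label-injective (smaller (ν x) x p) (smaller (ν y) y q) (trans eq (neg-label _ false)))
    ... | tri< p _ _ | tri> _ _ q = proper gx (Good-ν gy) a (toℕ-injective
          (trans (sym (toℕ-smaller x (ν x) p)) (trans (cong toℕ same) (toℕ-smaller (ν y) y q))))
      where same = proj₁ (label-injective (smaller x (ν x) p) (smaller (ν y) y q) (trans eq (neg-label _ false)))
    ... | tri> _ _ p | tri< q _ _ = proper (Good-ν gx) gy (adj-ν (bal gx) (bal gy) a) (toℕ-injective
          (trans (sym (toℕ-smaller (ν x) x p)) (trans (cong toℕ same) (toℕ-smaller y (ν y) q))))
      where same = proj₁ (label-injective (smaller (ν x) x p) (smaller y (ν y) q) (trans eq (neg-label _ true)))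

    alternating : Bool → List Pt → Bool
    alternating s σ = alt (1 + m′) s (map lab σ)

    antipodal : List (List Pt) → List (List Pt)
    antipodal h = h ++ map (map ν) h

    νν : ∀ σ → map ν (map ν σ) ≡ σ
    νν σ = trans (sym (map-∘ σ)) (map-id σ)

    ev-antipodal : ∀ φ h → ev φ (antipodal h) ≡ ev φ h xor ev (φ ∘ map ν) h
    ev-antipodal φ h = trans (ev-++ φ h _) (cong (ev φ h xor_) (ev-map φ (map ν) h))

    ev-antipodal-ν : ∀ φ h → ev (φ ∘ map ν) (antipodal h) ≡ ev φ (antipodal h)
    ev-antipodal-ν φ h = begin
      ev (φ ∘ map ν) (antipodal h)                       ≡⟨ ev-antipodal (φ ∘ map ν) h ⟩
      ev (φ ∘ map ν) h xor ev (φ ∘ map ν ∘ map ν) h      ≡⟨ cong (ev (φ ∘ map ν) h xor_) (ev-cong h (λ {σ} _ → cong φ (νν σ))) ⟩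
      ev (φ ∘ map ν) h xor ev φ h                        ≡⟨ xor-comm (ev (φ ∘ map ν) h) (ev φ h) ⟩
      ev φ h xor ev (φ ∘ map ν) h                        ≡⟨ sym (ev-antipodal φ h) ⟩
      ev φ (antipodal h)                                 ∎
      where open ≡-Reasoning

    -- The boundary h + νh of h′ is invariant under ν, so h′ and νh′ have equal boundaries, which
    -- cancel.
    antipodal-cycle : ∀ h h′ → h′ Bounds antipodal h → Cycle (antipodal h′)
    antipodal-cycle h h′ hb φ = begin
      ev (δ φ) (antipodal h′)                            ≡⟨ ev-antipodal (δ φ) h′ ⟩
      ev (δ φ) h′ xor ev (δ φ ∘ map ν) h′                ≡⟨ cong₂ _xor_ (hb φ) (ev-cong h′ (λ {σ} _ → δ-map ν φ σ)) ⟩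
      ev φ (antipodal h) xor ev (δ (φ ∘ map ν)) h′       ≡⟨ cong (ev φ (antipodal h) xor_) (trans (hb (φ ∘ map ν)) (ev-antipodal-ν φ h)) ⟩
      ev φ (antipodal h) xor ev φ (antipodal h)          ≡⟨ xor-same (ev φ (antipodal h)) ⟩
      false                                              ∎
      where open ≡-Reasoning

    antipodal-chain : ∀ {j d h} → Chain (Good j) d h → Chain (Good j) d (antipodal h)
    antipodal-chain {h = h} ch = Chain-++ h ch (Chain-map ν Good-ν (λ gx gy → adj-ν (bal gx) (bal gy)) ch)

    Good-≤ : ∀ {j x} → j ≤ 3 + m′ → Good j x → GoodPt x
    Good-≤ j≤ (good bl md (i , _ , p) (i′ , _ , q)) = good bl (λ i le → md i (≤-trans j≤ le)) (i , toℕ<n i , p) (i′ , toℕ<n i′ , q)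

    count : List (List Pt) → Bool
    count = ev (λ σ → alternating true σ xor alternating false σ)

    -- By `δ-alt` the count over h′ equals the number of facets alternating with sign `true`. These
    -- facets form h + νh, and ν exchanges the two signs, so h alone is counted with both.
    count-bounds : ∀ {d} h h′ → Chain GoodPt (suc d) h → Chain GoodPt (2 + d) h′ → h′ Bounds antipodal h → count h′ ≡ count h
    count-bounds h h′ ch ch′ hb = begin
      count h′                                                  ≡⟨ ev-cong h′ (λ {σ} σ∈ → sym (trans (sym (δ-map lab (alt (1 + m′) true) σ)) (δ-alt (1 + m′) true (map lab σ) (nc (ch′ σ∈))))) ⟩
      ev (δ (alternating true)) h′                              ≡⟨ hb (alternating true) ⟩
      ev (alternating true) (antipodal h)                       ≡⟨ ev-antipodal (alternating true) h ⟩
      ev (alternating true) h xor ev (alternating true ∘ map ν) h ≡⟨ cong (ev (alternating true) h xor_) (ev-cong h (λ {σ} σ∈ → flip σ (proj₁ (proj₂ (ch σ∈))))) ⟩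
      ev (alternating true) h xor ev (alternating false) h      ≡⟨ sym (ev-xor (alternating true) (alternating false) h) ⟩
      count h                                                   ∎
      where
      open ≡-Reasoning
      nc : ∀ {d σ} → length σ ≡ d × (∀ {x} → x ∈ σ → GoodPt x) × (∀ {x y} → x ∈ σ → y ∈ σ → adj x y) → NoComplementary (map lab σ)
      nc (_ , gσ , aσ) a∈ b∈ with ∈-map⁻ lab a∈ | ∈-map⁻ lab b∈
      ... | x , x∈ , refl | y , y∈ , eq = lab-complementary (gσ y∈) (gσ x∈) (aσ y∈ x∈) (sym eq)
      labs-ν : ∀ σ → (∀ {x} → x ∈ σ → GoodPt x) → map lab (map ν σ) ≡ map neg (map lab σ)
      labs-ν []      g = refl
      labs-ν (x ∷ σ) g = cong₂ _∷_ (lab-ν (g (here refl))) (labs-ν σ (g ∘ there))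
      flip : ∀ σ → (∀ {x} → x ∈ σ → GoodPt x) → alternating true (map ν σ) ≡ alternating false σ
      flip σ g = trans (cong (alt (1 + m′) true) (labs-ν σ g)) (alt-neg (1 + m′) true (map lab σ))

    pole : Pt
    pole zero          = k + k , 0
    pole (suc zero)    = 0 , k + k
    pole (suc (suc _)) = k , k

    pole-Good : Good 2 pole
    pole-Good = good bal′ mid′ (suc zero , s≤s (s≤s z≤n) , refl) (zero , s≤s z≤n , refl)
      where
      bal′ : Balanced pole
      bal′ zero          = +-identityʳ (k + k)
      bal′ (suc zero)    = refl
      bal′ (suc (suc _)) = refl
      mid′ : ∀ i → 2 ≤ toℕ i → pole i ≡ (k , k)
      mid′ (suc zero) (s≤s ())
      mid′ (suc (suc i)) _ = refl

    hemispheres : ∀ i → 2 + i ≤ 3 + m′ →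
      ∃ λ h → Chain (Good (2 + i)) (suc i) h × Cycle (antipodal h) × count h ≡ true
    hemispheres zero _ = (pole ∷ []) ∷ [] , ch , cyc , cnt
      where
      ch : Chain (Good 2) 1 ((pole ∷ []) ∷ [])
      ch (here refl) = refl , (λ { (here refl) → pole-Good }) , λ { (here refl) (here refl) → λ _ → close-refl }
      -- The pole and its antipode both have the empty simplex as facet, and its two occurrences
      -- cancel.
      cyc : Cycle (antipodal ((pole ∷ []) ∷ []))
      cyc φ with φ []
      ... | true  = refl
      ... | false = refl
      cnt : count ((pole ∷ []) ∷ []) ≡ true
      cnt = trans (xor-comm _ false) (alt-singleton (1 + m′) (lab pole))
    hemispheres (suc i) le with hemispheres i (<⇒≤ le)
    ... | h , ch , cyc , cnt = h′ , ch′ , antipodal-cycle h h′ hb ,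
          trans (count-bounds h h′ (Chain-⊆ (Good-≤ (<⇒≤ le)) ch) (Chain-⊆ (Good-≤ le) ch′) hb) cnt
      where
      J = fromℕ< le
      j≡ : toℕ J ≡ 2 + i
      j≡ = toℕ-fromℕ< le
      filled : Fills (Good (3 + i)) (suc i) (antipodal h)
      filled = subst (λ j → Fills (Good (suc j)) (suc i) (antipodal h)) j≡
        (Filling.fill J (subst (1 ≤_) (sym j≡) (s≤s z≤n)) (antipodal h) cyc
          (subst (λ j → Chain (Good j) (suc i) (antipodal h)) (sym j≡) (antipodal-chain ch)))
      h′  = proj₁ filled
      hb  = proj₁ (proj₂ filled)
      ch′ = proj₂ (proj₂ filled)

    no-colouring : ⊥
    -- These simplices have 2 + m′ vertices, one more than there are absolute values, so none
    -- alternates.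
    no-colouring with hemispheres (1 + m′) ≤-refl
    ... | h , ch , _ , cnt with trans (sym cnt) (trans (ev-cong h (λ {σ} σ∈ → cong₂ _xor_ (long true σ (proj₁ (ch σ∈))) (long false σ (proj₁ (ch σ∈))))) (ev-zero h))
      where
      long : ∀ s σ → length σ ≡ 2 + m′ → alternating s σ ≡ false
      long s σ len with alternating s σ in eq
      ... | false = refl
      ... | true  = ⊥-elim (1+n≰n (subst (_≤ 1 + m′) (trans (length-map lab σ) len) (alt-length (1 + m′) s (map lab σ) eq)))
    ... | ()

-- Helical graphs

-- Validity is an irrelevant field of a vertex; deciding it makes `recompute` available.
isHelical? : ∀ m n k (A : Vec (Subset m) k) → Dec (IsHelical m n k A)
isHelical? m n k A =
  Fin.all? (λ i → (toℕ i ≟ 0) →-dec (∣ lookup A i ∣ ≟ n)) ×-dec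
  Fin.all? (λ i → n ≤? ∣ lookup A i ∣) ×-dec
  Fin.all? (λ i → Fin.all? (λ j → (toℕ j ≟ suc (toℕ i)) →-dec ¬? (nonempty? (lookup A i ∩ lookup A j)))) ×-dec
  Fin.all? (λ i → Fin.all? (λ j → (toℕ j ≟ 2 + toℕ i) →-dec (lookup A i ⊆? lookup A j)))

allVecs : ∀ {A : Set} → List A → ∀ n → List (Vec A n)
allVecs xs zero    = [] ∷ []
allVecs xs (suc n) = cartesianProductWith _∷_ xs (allVecs xs n)

∈-allVecs : ∀ {A : Set} {xs : List A} → (∀ x → x ∈ xs) → ∀ {n} (v : Vec A n) → v ∈ allVecs xs n
∈-allVecs all []      = here refl
∈-allVecs all (x ∷ v) = ∈-cartesianProductWith⁺ _∷_ (all x) (∈-allVecs all v)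

allSubsets : ∀ m → List (Subset m)
allSubsets = allVecs (true ∷ false ∷ [])

∈-allSubsets : ∀ {m} (p : Subset m) → p ∈ allSubsets m
∈-allSubsets = ∈-allVecs λ { true → here refl ; false → there (here refl) }

module HelicalGraph (m n k : ℕ) where

  H : Graph
  H = Helical m n k

  private
    sets = HVertex.sets

  valid : (A : V H) → IsHelical m n k (sets A)
  valid (hv A ok) = recompute (isHelical? m n k A) ok

  validVertices : List (Vec (Subset m) k) → List (V H)
  validVertices []       = []
  validVertices (A ∷ As) with isHelical? m n k A
  ... | yes ok = hv A ok ∷ validVertices As
  ... | no  _  = validVertices As

  ∈-validVertices : ∀ {As} A .(ok : IsHelical m n k A) → A ∈ As → hv A ok ∈ validVertices As
  ∈-validVertices {B ∷ As} A ok A∈ with isHelical? m n k B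
  ∈-validVertices A ok (here refl) | yes _  = here refl
  ∈-validVertices A ok (there A∈)  | yes _  = there (∈-validVertices A ok A∈)
  ∈-validVertices A ok (there A∈)  | no _   = ∈-validVertices A ok A∈
  ∈-validVertices A ok (here refl) | no bad = ⊥-elim (bad (recompute (isHelical? m n k A) ok))

  vertices : List (V H)
  vertices = validVertices (allVecs (allSubsets m) k)

  ∈-vertices : ∀ A → A ∈ vertices
  ∈-vertices (hv A ok) = ∈-validVertices A ok (∈-allVecs ∈-allSubsets A)

  H-sym : Sym H
  H-sym A B (dis , inc) =
    (λ i → λ { (x , x∈) → dis i (x , x∈p∩q⁺ (swap (x∈p∩q⁻ _ _ x∈))) }) ,
    (λ i j eq → swap (inc i j eq))

  _~?_ : ∀ A B → Dec (_~_ H A B)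
  A ~? B =
    Fin.all? (λ i → ¬? (nonempty? (lookup (sets A) i ∩ lookup (sets B) i))) ×-dec
    Fin.all? (λ i → Fin.all? (λ j → (toℕ j ≟ suc (toℕ i)) →-dec
      ((lookup (sets A) i ⊆? lookup (sets B) j) ×-dec (lookup (sets B) i ⊆? lookup (sets A) j))))

  _≟ᴴ_ : ∀ (A B : V H) → Dec (A ≡ B)
  hv A _ ≟ᴴ hv B _ = map′ (λ { refl → refl }) (λ { refl → refl }) (Vec.≡-dec (Vec.≡-dec Bool._≟_) A B)

  walk? : ∀ t A B → Dec (Walk H t A B)
  walk? zero    A B = map′ (λ { refl → [] }) (λ { [] → refl }) (A ≟ᴴ B)
  walk? (suc t) A B = map′ to from (Any.any? (λ C → (A ~? C) ×-dec walk? t C B) vertices)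
    where
    to : Any (λ C → _~_ H A C × Walk H t C B) vertices → Walk H (suc t) A B
    to any with _ , _ , e , p ← find any = e ∷ p
    from : Walk H (suc t) A B → Any (λ C → _~_ H A C × Walk H t C B) vertices
    from (e ∷ p) = lose (∈-vertices _) (e , p)

  -- Each edge carries the i-th set of one end into the (i+1)-st set of the other.
  walk-⊆ : ∀ {t A B} → Walk H t A B → ∀ i j → toℕ j ≡ t + toℕ i → lookup (sets A) i ⊆ lookup (sets B) j
  walk-⊆ [] i j eq with refl ← Fin.toℕ-injective eq = λ x∈ → x∈
  walk-⊆ {suc t} (_∷_ {w = C} e p) i j eq x∈ =
    walk-⊆ p i′ j (trans eq (trans (sym (+-suc t (toℕ i))) (cong (t +_) (sym i′≡)))) (proj₁ (proj₂ e i i′ i′≡) x∈)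
    where
    bound : suc (toℕ i) < k
    bound = ≤-<-trans (subst (suc (toℕ i) ≤_) (sym eq) (s≤s (m≤n+m (toℕ i) t))) (Fin.toℕ<n j)
    i′ = fromℕ< bound
    i′≡ : toℕ i′ ≡ suc (toℕ i)
    i′≡ = Fin.toℕ-fromℕ< bound

module Colour (m′ k′ : ℕ) where

  private
    m k D : ℕ
    m = suc m′
    k = suc k′
    D = suc (2 * k′)

  open HelicalGraph m 1 k

  colour : V H → Fin m
  colour A with nonempty? (lookup (HVertex.sets A) zero)
  ... | yes (x , _) = x
  ... | no _        = zero

  colour-∈ : ∀ A → colour A ∈ˢ lookup (HVertex.sets A) zero
  colour-∈ A with nonempty? (lookup (HVertex.sets A) zero)
  ... | yes (x , x∈) = x∈
  ... | no empty with trans (sym (trans (cong ∣_∣ (Empty-unique empty)) (∣⊥∣≡0 m))) (proj₁ (valid A) zero refl)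
  ... | ()

  D≡ : D ≡ k′ + suc k′
  D≡ = trans (cong suc (cong (k′ +_) (+-identityʳ k′))) (sym (+-suc k′ k′))

  -- Since D = k′ + 1 + k′, the walk has a middle edge. A common colour would be carried k′ steps
  -- from both ends into the last sets of that edge, which are disjoint.
  colour-wide : ∀ {A B} → Walk H D A B → colour A ≢ colour B
  colour-wide {A} {B} p eq with walk-split k′ (walk-length D≡ p)
  ... | A′ , q , (e ∷ r) = proj₁ e (fromℕ k′)
      (colour A , x∈p∩q⁺ (walk-⊆ q zero (fromℕ k′) top (colour-∈ A) ,
        walk-⊆ (walk-reverse H-sym r) zero (fromℕ k′) top (subst (_∈ˢ lookup (HVertex.sets B) zero) (sym eq) (colour-∈ B))))
    where
    top : toℕ (fromℕ k′) ≡ k′ + 0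
    top = trans (Fin.toℕ-fromℕ k′) (sym (+-identityʳ k′))

-- Helical vertices from the grid

module _ {m : ℕ} {P : Fin m → Set} (P? : ∀ j → Dec (P j)) where

  subset : Subset m
  subset = tabulate (does ∘ P?)

  ∈-subset⁺ : ∀ {j} → P j → j ∈ˢ subset
  ∈-subset⁺ {j} pj = lookup⇒[]= j subset (trans (lookup∘tabulate (does ∘ P?) j) (dec-true (P? j) pj))

  ∈-subset⁻ : ∀ {j} → j ∈ˢ subset → P j
  ∈-subset⁻ {j} j∈ with P? j | trans (sym (lookup∘tabulate (does ∘ P?) j)) ([]=⇒lookup j∈)
  ... | yes pj | _  = pj
  ... | no _   | ()

∣∣≥1 : ∀ {m} {p : Subset m} {x} → x ∈ˢ p → 1 ≤ ∣ p ∣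
∣∣≥1 {p = p} {x} x∈ = subst (_≤ ∣ p ∣) (∣⁅x⁆∣≡1 x) (p⊆q⇒∣p∣≤∣q∣ λ y∈ → subst (_∈ˢ p) (sym (x∈⁅y⁆⇒x≡y x y∈)) x∈)

module Sequences (m k : ℕ) where

  record Seq (s : ℕ → Subset m) : Set where
    field
      single   : ∃ λ x → s 0 ≡ ⁅ x ⁆
      nonempty : ∀ i → i < k → ∃ λ x → x ∈ˢ s i
      disjoint : ∀ i → suc i < k → ∀ {x} → x ∈ˢ s i → x ∈ˢ s (suc i) → ⊥
      mono     : ∀ i → 2 + i < k → ∀ {x} → x ∈ˢ s i → x ∈ˢ s (2 + i)

  sets : (ℕ → Subset m) → Vec (Subset m) k
  sets s = tabulate (s ∘ toℕ)

  lookup-sets : ∀ s i → lookup (sets s) i ≡ s (toℕ i)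
  lookup-sets s = lookup∘tabulate (s ∘ toℕ)

  private
    to : ∀ s i {x} → x ∈ˢ lookup (sets s) i → x ∈ˢ s (toℕ i)
    to s i {x} = subst (x ∈ˢ_) (lookup-sets s i)
    from : ∀ s i {x} → x ∈ˢ s (toℕ i) → x ∈ˢ lookup (sets s) i
    from s i {x} = subst (x ∈ˢ_) (sym (lookup-sets s i))

  helical : ∀ {s} → Seq s → IsHelical m 1 k (sets s)
  helical {s} q =
    (λ i i≡0 → trans (cong ∣_∣ (trans (lookup-sets s i) (trans (cong s i≡0) (proj₂ (Seq.single q))))) (∣⁅x⁆∣≡1 (proj₁ (Seq.single q)))) ,
    (λ i → ∣∣≥1 (from s i (proj₂ (Seq.nonempty q (toℕ i) (Fin.toℕ<n i))))) ,
    (λ i j j≡ → λ { (x , x∈) → Seq.disjoint q (toℕ i) (subst (_< k) j≡ (Fin.toℕ<n j))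
      (to s i (proj₁ (x∈p∩q⁻ (lookup (sets s) i) _ x∈)))
      (subst (λ n → x ∈ˢ s n) j≡ (to s j (proj₂ (x∈p∩q⁻ (lookup (sets s) i) _ x∈)))) }) ,
    (λ i j j≡ {x} x∈ → from s j (subst (λ n → x ∈ˢ s n) (sym j≡) (Seq.mono q (toℕ i) (subst (_< k) j≡ (Fin.toℕ<n j)) (to s i x∈))))

  vertex : ∀ s → .(Seq s) → HVertex m 1 k
  vertex s q = hv (sets s) (helical q)

  sets-adj : ∀ s s′ .(q : IsHelical m 1 k (sets s)) .(q′ : IsHelical m 1 k (sets s′)) →
    (∀ i → i < k → ∀ {x} → x ∈ˢ s i → x ∈ˢ s′ i → ⊥) →
    (∀ i → suc i < k → ∀ {x} → (x ∈ˢ s i → x ∈ˢ s′ (suc i)) × (x ∈ˢ s′ i → x ∈ˢ s (suc i))) →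
    HAdj {m} {1} {k} (hv (sets s) q) (hv (sets s′) q′)
  sets-adj s s′ q q′ dis inc =
    (λ i → λ { (x , x∈) → dis (toℕ i) (Fin.toℕ<n i)
      (to s i (proj₁ (x∈p∩q⁻ (lookup (sets s) i) _ x∈))) (to s′ i (proj₂ (x∈p∩q⁻ (lookup (sets s) i) _ x∈))) }) ,
    (λ i j j≡ →
      (λ {x} x∈ → from s′ j (subst (λ n → x ∈ˢ s′ n) (sym j≡) (proj₁ (inc (toℕ i) (subst (_< k) j≡ (Fin.toℕ<n j))) (to s i x∈)))) ,
      (λ {x} x∈ → from s j (subst (λ n → x ∈ˢ s n) (sym j≡) (proj₂ (inc (toℕ i) (subst (_< k) j≡ (Fin.toℕ<n j))) (to s′ i x∈)))))

module GridVertices (m′ k : ℕ) where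

  private
    m : ℕ
    m = 3 + m′

  open Grid m k
  open Good
  open Sequences m k

  side : ℕ → ℕ × ℕ → ℕ
  side zero    = proj₂
  side (suc i) = side i ∘ swap

  side-sum : ∀ i {p} → proj₁ p + proj₂ p ≡ k + k → side i p + side (suc i) p ≡ k + k
  side-sum zero    {a , b} eq = trans (+-comm b a) eq
  side-sum (suc i) {a , b} eq = side-sum i (trans (+-comm b a) eq)

  side-close : ∀ i {p q} → close (proj₁ p) (proj₂ q) → close (proj₂ p) (proj₁ q) → close (side i p) (side (suc i) q)
  side-close zero    u v = v
  side-close (suc i) u v = side-close i v u

  topIndex : Pt → Fin m
  topIndex x with Fin.any? (λ i → proj₂ (x i) ≟ 0)
  ... | yes (i , _) = i
  ... | no _        = zero

  topIndex-zero : ∀ {x} → Good m x → proj₂ (x (topIndex x)) ≡ 0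
  topIndex-zero {x} g with Fin.any? (λ i → proj₂ (x i) ≟ 0)
  ... | yes (i , eq) = eq
  ... | no none      = ⊥-elim (none (proj₁ (top g) , proj₂ (proj₂ (top g))))

  side-≤? : ∀ (x : Pt) i j → Dec (side i (x j) ≤ i)
  side-≤? x i j = side i (x j) ≤? i

  -- At index i, the coordinates within i of the maximum for even i and of the minimum for odd i. At
  -- index 0 a single coordinate is chosen, as the first set has size 1.
  level : Pt → ℕ → Subset m
  level x zero    = ⁅ topIndex x ⁆
  level x (suc i) = subset (side-≤? x (suc i))

  ∈-level⁻ : ∀ {x} → Good m x → ∀ i {j} → j ∈ˢ level x i → side i (x j) ≤ i
  ∈-level⁻ g zero    j∈ with refl ← x∈⁅y⁆⇒x≡y _ j∈ = ≤-reflexive (topIndex-zero g)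
  ∈-level⁻ {x} g (suc i) j∈ = ∈-subset⁻ (side-≤? x (suc i)) j∈

  ∈-level⁺ : ∀ x i {j} → side (suc i) (x j) ≤ suc i → j ∈ˢ level x (suc i)
  ∈-level⁺ x i = ∈-subset⁺ (side-≤? x (suc i))

  sum-small : ∀ {a b i} → a + b ≡ k + k → a ≤ i → b ≤ suc i → i < k → ⊥
  sum-small {a} {b} {i} eq a≤ b≤ i<k = 1+n≰n (begin
    suc (k + k)     ≡⟨ cong suc (sym eq) ⟩
    suc (a + b)     ≤⟨ s≤s (+-mono-≤ a≤ b≤) ⟩
    suc i + suc i   ≤⟨ +-mono-≤ i<k i<k ⟩
    k + k           ∎)
    where open ≤-Reasoning

  extreme : ∀ {x} → Good m x → ∀ i → ∃ λ j → side i (x j) ≡ 0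
  extreme g zero    = proj₁ (top g) , proj₂ (proj₂ (top g))
  extreme g (suc i) = extreme (Good-ν g) i

  level-seq : ∀ {x} → Good m x → Seq (level x)
  level-seq {x} g = record
    { single   = topIndex x , refl
    ; nonempty = λ { zero _ → topIndex x , x∈⁅x⁆ _
                   ; (suc i) _ → proj₁ (extreme g (suc i)) , ∈-level⁺ x i (≤-trans (≤-reflexive (proj₂ (extreme g (suc i)))) z≤n) }
    ; disjoint = λ i i<k {j} p q → sum-small (side-sum i (bal g j)) (∈-level⁻ g i p) (∈-level⁻ g (suc i) q) (<⇒≤ i<k)
    ; mono     = λ i _ {j} p → ∈-level⁺ x (suc i) (≤-trans (∈-level⁻ g i p) (≤-trans (n≤1+n i) (n≤1+n (suc i))))
    }

  -- A coordinate with `side i` at most i in x has `side (suc i)` at most i + 1 in y, and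
  -- conversely: these are the inclusions. If it had `side i` at most i in both, its two sides in x
  -- would sum to at most 2i + 1 < 2k.
  level-adj : ∀ {x y} (gx : Good m x) (gy : Good m y) → adj x (ν y) →
    .(q : IsHelical m 1 k (sets (level x))) .(q′ : IsHelical m 1 k (sets (level y))) →
    HAdj {m} {1} {k} (hv (sets (level x)) q) (hv (sets (level y)) q′)
  level-adj {x} {y} gx gy a q q′ = sets-adj (level x) (level y) q q′
    (λ i i<k {j} p p′ → sum-small (side-sum i (bal gx j)) (∈-level⁻ gx i p)
      (≤-trans (proj₂ (near i j)) (s≤s (∈-level⁻ gy i p′))) i<k)
    (λ i i<k {j} → (λ p → ∈-level⁺ y i (≤-trans (proj₂ (near′ i j)) (s≤s (∈-level⁻ gx i p)))) ,
                   (λ p → ∈-level⁺ x i (≤-trans (proj₂ (near i j)) (s≤s (∈-level⁻ gy i p)))))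
    where
    a′ : adj (ν x) y
    a′ = adj-ν (bal gx) (bal (Good-ν gy)) a
    near′ : ∀ i j → close (side i (x j)) (side (suc i) (y j))
    near′ i j = side-close i (a j) (a′ j)
    near : ∀ i j → close (side i (y j)) (side (suc i) (x j))
    near i j = side-close i (swap (a′ j)) (swap (a j))

  helical-uncolourable : ¬ Colorable (Helical m 1 k) (2 + m′)
  helical-uncolourable (f , ok) = Colouring.no-colouring m′ k c proper
    where
    c : Pt → Fin (2 + m′)
    c x with isHelical? m 1 k (sets (level x))
    ... | yes q = f (hv (sets (level x)) q)
    -- Only good points are sure to give a vertex; elsewhere any colour will do.
    ... | no _  = zero
    proper : ∀ {x y} → Good m x → Good m y → adj x (ν y) → c x ≢ c y
    proper {x} {y} gx gy a with isHelical? m 1 k (sets (level x)) | isHelical? m 1 k (sets (level y))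
    ... | yes q | yes q′ = ok _ _ (level-adj gx gy a q q′)
    ... | no ¬q | _      = contradiction (helical (level-seq gx)) ¬q
    ... | _     | no ¬q  = contradiction (helical (level-seq gy)) ¬q

-- Endomorphisms of finite graphs

module _ {A : Set} where

  count : ∀ {P : A → Set} → (∀ x → Dec (P x)) → List A → ℕ
  count P? []       = 0
  count P? (x ∷ xs) with P? x
  ... | yes _ = suc (count P? xs)
  ... | no _  = count P? xs

  module _ {P Q : A → Set} (P? : ∀ x → Dec (P x)) (Q? : ∀ x → Dec (Q x)) (P⊆Q : ∀ {x} → P x → Q x) where

    count-mono : ∀ xs → count P? xs ≤ count Q? xs
    count-mono []       = z≤n
    count-mono (x ∷ xs) with P? x | Q? x
    ... | yes _ | yes _ = s≤s (count-mono xs)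
    ... | yes p | no ¬q = contradiction (P⊆Q p) ¬q
    ... | no _  | yes _ = m≤n⇒m≤1+n (count-mono xs)
    ... | no _  | no _  = count-mono xs

    count-strict : ∀ {y} xs → y ∈ xs → Q y → ¬ P y → count P? xs < count Q? xs
    count-strict (x ∷ xs) (here refl) qy ¬py with P? x | Q? x
    ... | yes p | _     = contradiction p ¬py
    ... | no _  | yes _ = s≤s (count-mono xs)
    ... | no _  | no ¬q = contradiction qy ¬q
    count-strict (x ∷ xs) (there y∈) qy ¬py with P? x | Q? x
    ... | yes _ | yes _ = s≤s (count-strict xs y∈ qy ¬py)
    ... | yes p | no ¬q = contradiction (P⊆Q p) ¬q
    ... | no _  | yes _ = m≤n⇒m≤1+n (count-strict xs y∈ qy ¬py)
    ... | no _  | no _  = count-strict xs y∈ qy ¬py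

  count≤length : ∀ {P : A → Set} (P? : ∀ x → Dec (P x)) xs → count P? xs ≤ length xs
  count≤length P? []       = z≤n
  count≤length P? (x ∷ xs) with P? x
  ... | yes _ = s≤s (count≤length P? xs)
  ... | no _  = m≤n⇒m≤1+n (count≤length P? xs)

module Rigidity (X : Graph) (irrefl : ∀ v → ¬ _~_ X v v) (X-sym : Sym X)
  (_≟_ : ∀ (u v : V X) → Dec (u ≡ v)) (vs : List (V X)) (∈-vs : ∀ v → v ∈ vs) where

  infix 4 _∼_
  _∼_ = _~_ X

  code : V X → Fin (length vs)
  code v = Any.index (∈-vs v)

  code-injective : ∀ {u v} → code u ≡ code v → u ≡ v
  code-injective {u} {v} eq = trans (lookup-index (∈-vs u)) (trans (cong (List.lookup vs) eq) (sym (lookup-index (∈-vs v))))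

  -- Distinguishes a pair of different vertices from its reverse by their places in `vs`; the value
  -- serves as a colour.
  order : V X → V X → Fin 2
  order u v with <-cmp (toℕ (code u)) (toℕ (code v))
  ... | tri< _ _ _ = zero
  ... | tri≈ _ _ _ = zero
  ... | tri> _ _ _ = suc zero

  order-flip : ∀ {u v} → u ≢ v → order u v ≢ order v u
  order-flip {u} {v} u≢v with <-cmp (toℕ (code u)) (toℕ (code v)) | <-cmp (toℕ (code v)) (toℕ (code u))
  ... | tri≈ _ eq _ | _           = λ _ → u≢v (code-injective (Fin.toℕ-injective eq))
  ... | _           | tri≈ _ eq _ = λ _ → u≢v (sym (code-injective (Fin.toℕ-injective eq)))
  ... | tri< p _ _  | tri< q _ _  = λ _ → <-asym p q
  ... | tri> _ _ p  | tri> _ _ q  = λ _ → <-asym p q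
  ... | tri< _ _ _  | tri> _ _ _  = λ ()
  ... | tri> _ _ _  | tri< _ _ _  = λ ()

  -- The image of ε then acts as a core. The condition is on ψ ∘ ε, so ψ may be altered on the image
  -- without regard to the rest of X.
  Minimal : (V X → V X) → Set
  Minimal ε = ∀ ψ → Hom X X (ψ ∘ ε) → ∀ x y → ψ (ε x) ≡ ψ (ε y) → ε x ≡ ε y

  pairs : List (V X × V X)
  pairs = cartesianProduct vs vs

  collapsed? : ∀ (ε : V X → V X) p → Dec (ε (proj₁ p) ≡ ε (proj₂ p))
  collapsed? ε (x , y) = ε x ≟ ε y

  rank : (V X → V X) → ℕ
  rank ε = count (collapsed? ε) pairs

  -- Starting from the identity, a failure of minimality yields an endomorphism identifying more
  -- pairs, and there are finitely many pairs. Minimality quantifies over all maps and is not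
  -- decided, hence the double negation.
  ¬¬minimal : ¬ (∀ ε → Hom X X ε → ¬ Minimal ε)
  ¬¬minimal none = go (length pairs) (λ x → x) (λ _ _ e → e) (m≤m+n _ _)
    where
    grows : ∀ ε ψ x y → ψ (ε x) ≡ ψ (ε y) → ε x ≢ ε y → rank ε < rank (ψ ∘ ε)
    grows ε ψ x y eq ne = count-strict (collapsed? ε) (collapsed? (ψ ∘ ε)) (λ {p} → cong ψ) pairs
      (∈-cartesianProduct⁺ (∈-vs x) (∈-vs y)) eq ne
    go : ∀ fuel ε → Hom X X ε → length pairs ≤ fuel + rank ε → ⊥
    go fuel ε hom bound = none ε hom minimal
      where
      next : ∀ fuel ψ → Hom X X (ψ ∘ ε) → rank ε < rank (ψ ∘ ε) → length pairs ≤ fuel + rank ε → ⊥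
      next zero       ψ ψhom lt b = <⇒≱ lt (≤-trans (count≤length (collapsed? (ψ ∘ ε)) pairs) b)
      next (suc fuel) ψ ψhom lt b = go fuel (ψ ∘ ε) ψhom (≤-trans b (≤-trans (≤-reflexive (sym (+-suc fuel _))) (+-monoʳ-≤ fuel lt)))
      minimal : Minimal ε
      minimal ψ ψhom x y eq with ε x ≟ ε y
      ... | yes same = same
      ... | no ne    = ⊥-elim (next fuel ψ ψhom (grows ε ψ x y eq ne) bound)

  module AtMinimal (ε : V X → V X) (ε-hom : Hom X X ε) (ε-min : Minimal ε) where

    Core : V X → Set
    Core v = ∃ λ x → v ≡ ε x

    Endo : (V X → V X) → Set
    Endo g = Hom X X (g ∘ ε) × (∀ x → Core (g (ε x)))

    injective : ∀ {g u v} → Endo g → Core u → Core v → g u ≡ g v → u ≡ v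
    injective {g} (ghom , _) (x , refl) (y , refl) eq = ε-min g ghom x y eq

    iterate : (V X → V X) → V X → ℕ → V X
    iterate g v zero    = v
    iterate g v (suc i) = g (iterate g v i)

    -- By the pigeonhole principle the orbit of v repeats, and injectivity moves the repetition back
    -- to v itself.
    surjective : ∀ {g v} → Endo g → Core v → ∃ λ u → Core u × g u ≡ v
    surjective {g} {v} ge cv with Fin.pigeonhole (n<1+n (length vs)) (λ i → code (iterate g v (toℕ i)))
    ... | i , j , i<j , eq = back (toℕ i) (toℕ j) i<j (code-injective eq)
      where
      inCore : ∀ i → Core (iterate g v i)
      inCore zero    = cv
      inCore (suc i) with x , eq ← inCore i = subst (Core ∘ g) (sym eq) (proj₂ ge x)
      back : ∀ i j → i < j → iterate g v i ≡ iterate g v j → ∃ λ u → Core u × g u ≡ v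
      back zero    (suc j) _         eq = iterate g v j , inCore j , sym eq
      back (suc i) (suc j) (s≤s i<j) eq = back i j i<j (injective {g} ge (inCore i) (inCore j) eq)

    override : (V X → V X) → V X → V X → V X → V X
    override g v w u with u ≟ v
    ... | yes _ = w
    ... | no _  = g u

    override-at : ∀ g v w → override g v w v ≡ w
    override-at g v w with v ≟ v
    ... | yes _  = refl
    ... | no v≢v = ⊥-elim (v≢v refl)

    override-off : ∀ g v w {u} → u ≢ v → override g v w u ≡ g u
    override-off g v w {u} u≢v with u ≟ v
    ... | yes u≡v = ⊥-elim (u≢v u≡v)
    ... | no _    = refl

    -- An endomorphism of the core is a bijection, so its value at one vertex
    -- is determined by the others.
    rigid : ∀ {g v w} → Endo g → Core v → Core w → (∀ a → Core a → v ∼ a → w ∼ g a) → w ≡ g v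
    rigid {g} {v} {w} ge cv cw adjacent with surjective ge cw
    ... | u , cu , gu≡w with u ≟ v
    ... | yes refl = sym gu≡w
    -- Otherwise g with its value at v changed to w is again an endomorphism, but takes the value w
    -- at both u and v.
    ... | no u≢v = ⊥-elim (u≢v (injective ψe cu cv (trans (override-off g v w u≢v) (trans gu≡w (sym (override-at g v w))))))
      where
      ψ = override g v w
      ψhom : Hom X X (ψ ∘ ε)
      ψhom x y e with ε x ≟ v | ε y ≟ v
      ... | yes refl | yes eq   = ⊥-elim (irrefl _ (subst (ε x ∼_) eq (ε-hom x y e)))
      ... | yes refl | no _     = adjacent (ε y) (y , refl) (ε-hom x y e)
      ... | no _     | yes refl = X-sym _ _ (adjacent (ε x) (x , refl) (X-sym _ _ (ε-hom x y e)))
      ... | no _     | no _     = proj₁ ge x y e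
      ψe : Endo ψ
      ψe = ψhom , λ x → coreψ x
        where
        coreψ : ∀ x → Core (ψ (ε x))
        coreψ x with ε x ≟ v
        ... | yes _ = cw
        ... | no _  = proj₂ ge x

  -- With N = 2N′ + 1, read `f v v′ t` as the image of the point at distance t from v on the edge v
  -- v′ cut into N parts, and `h` as the image of the vertices. The pairs in `f-one` and `f-two` are
  -- joined by walks of length N + 2.
  module _ (N′ : ℕ) (h : V X → V X) (f : V X → V X → ℕ → V X)
    (nbr? : ∀ v → Dec (∃ λ v′ → v ∼ v′))
    (f-tgt : ∀ {v v′} → v ∼ v′ → f v v′ (suc (2 * N′)) ≡ h v′)
    (h-hom : Hom X X h)
    (f-one : ∀ {v v′ a a′} → v ∼ a → v ∼ v′ → a ∼ a′ → f v v′ 1 ∼ f a a′ 1)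
    (f-two : ∀ {v v′ a} t → 2 + t ≤ suc (2 * N′) → v ∼ a → v ∼ v′ → f v v′ (2 + t) ∼ f a v t) where

    ¬¬bipartite : ¬ ¬ Colorable X 2
    ¬¬bipartite nonbip = ¬¬minimal λ ε ε-hom ε-min → nonbip (bipartite ε ε-hom ε-min)
      where
      module _ (ε : V X → V X) (ε-hom : Hom X X ε) (ε-min : Minimal ε) where
        open AtMinimal ε ε-hom ε-min

        g₀ g₁ : V X → V X
        g₀ v = ε (h v)
        g₁ v with nbr? v
        ... | yes (v′ , _) = ε (f v v′ 1)
        -- An isolated vertex gets a value in the core, as `Endo` demands.
        ... | no _         = ε v

        endo₀ : Endo g₀
        endo₀ = (λ x y e → ε-hom _ _ (h-hom _ _ (ε-hom x y e))) , λ x → _ , refl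

        g₁-nbr : ∀ {v} → (∃ λ v′ → v ∼ v′) → ∃ λ v′ → v ∼ v′ × g₁ v ≡ ε (f v v′ 1)
        g₁-nbr {v} nb with nbr? v
        ... | yes (v′ , e) = v′ , e , refl
        ... | no none      = ⊥-elim (none nb)

        endo₁ : Endo g₁
        endo₁ = ghom , core
          where
          ghom : Hom X X (g₁ ∘ ε)
          ghom x y e with g₁-nbr (ε y , ε-hom x y e) | g₁-nbr (ε x , X-sym _ _ (ε-hom x y e))
          ... | v′ , e₁ , eq₁ | a′ , e₂ , eq₂ = subst₂ _∼_ (sym eq₁) (sym eq₂) (ε-hom _ _ (f-one (ε-hom x y e) e₁ e₂))
          core : ∀ x → Core (g₁ (ε x))
          core x with nbr? (ε x)
          ... | yes _ = _ , refl
          ... | no _  = _ , refl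

        -- The choice of v′ does not matter: by `f-one` the value is adjacent to g₁ a for every
        -- neighbour a of v in the core, so `rigid` identifies it.
        at-one : ∀ {v v′} → Core v → v ∼ v′ → ε (f v v′ 1) ≡ g₁ v
        at-one {v} {v′} cv e = rigid endo₁ cv (_ , refl) adjacent
          where
          adjacent : ∀ a → Core a → v ∼ a → ε (f v v′ 1) ∼ g₁ a
          adjacent a ca va with g₁-nbr (v , X-sym _ _ va)
          ... | a′ , e′ , eq = subst (ε (f v v′ 1) ∼_) (sym eq) (ε-hom _ _ (f-one va e e′))

        -- The value at t + 2 on v v′ is adjacent to the value at t on a v, which is g₁ a by
        -- induction. This holds for every neighbour a in the core, so `rigid` applies again at v.
        at-odd : ∀ i → 2 * i + 1 ≤ suc (2 * N′) → ∀ {v v′} → Core v → v ∼ v′ → ε (f v v′ (2 * i + 1)) ≡ g₁ v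
        at-odd zero    le cv e = at-one cv e
        at-odd (suc i) le {v} {v′} cv e =
          subst (λ t → ε (f v v′ t) ≡ g₁ v) (sym t≡)
            (rigid endo₁ cv (_ , refl) λ a ca va →
              subst (ε (f v v′ (2 + (2 * i + 1))) ∼_) (at-odd i (≤-trans (≤-trans (n≤1+n _) (n≤1+n _)) le′) ca (X-sym _ _ va))
                (ε-hom _ _ (f-two (2 * i + 1) le′ va e)))
          where
          t≡ : 2 * suc i + 1 ≡ 2 + (2 * i + 1)
          t≡ = cong (_+ 1) (*-suc 2 i)
          le′ : 2 + (2 * i + 1) ≤ suc (2 * N′)
          le′ = subst (_≤ suc (2 * N′)) t≡ le

        at-end : ∀ {v v′} → Core v → v ∼ v′ → g₀ v′ ≡ g₁ v
        at-end {v} {v′} cv e = trans (cong ε (sym (f-tgt e)))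
          (subst (λ t → ε (f v v′ t) ≡ g₁ v) (+-comm (2 * N′) 1) (at-odd N′ (≤-reflexive (+-comm (2 * N′) 1)) cv e))

        bipartite : Colorable X 2
        -- By `at-end` the pair (g₀ , g₁) at one end of an edge is the reverse of the pair at the
        -- other end. Its entries are adjacent, hence different, and `order` separates the ends.
        bipartite = (λ x → order (g₀ (ε x)) (g₁ (ε x))) , proper
          where
          proper : ∀ x y → x ∼ y → order (g₀ (ε x)) (g₁ (ε x)) ≢ order (g₀ (ε y)) (g₁ (ε y))
          proper x y e = subst₂ (λ a b → order (g₀ (ε x)) a ≢ order (g₀ (ε y)) b)
            (at-end (x , refl) (ε-hom x y e)) (at-end (y , refl) (X-sym _ _ (ε-hom x y e)))
            (order-flip λ eq → irrefl _ (subst (g₀ (ε x) ∼_) (sym eq) (proj₁ endo₀ x y e)))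

-- Subdivisions

-- Every ordered adjacent pair contributes its own path, so that no choice of
-- an orientation is needed.

module Paths (G : Graph) (n : ℕ) where

  private
    infix 4 _∼_
    _∼_ = _~_ G

  -- An `inn` point with t = 0 lies on no path, as `mid` asks for 0 < t; it is isolated, which is
  -- one reason for `Linked` below.
  data Point : Set where
    orig : V G → Point
    inn  : ∀ v v′ → .(v ∼ v′) → ∀ t → .(t < n) → Point

  data On (v v′ : V G) : ℕ → Point → Set where
    src : On v v′ 0 (orig v)
    tgt : On v v′ n (orig v′)
    mid : ∀ t → 0 < t → .(a : v ∼ v′) (t<n : t < n) → On v v′ t (inn v v′ a t t<n)

  Step : Point → Point → Set
  Step P Q = ∃ λ v → ∃ λ v′ → v ∼ v′ × ∃ λ t → (On v v′ t P × On v v′ (suc t) Q) ⊎ (On v v′ (suc t) P × On v v′ t Q)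

  Ŝ : Graph
  Ŝ = record { V = Point ; _~_ = Step }

  Step-sym : Sym Ŝ
  Step-sym P Q (v , v′ , a , t , s) = v , v′ , a , t , Sum.swap (Sum.map swap swap s)

  On-≤ : ∀ {v v′ t P} → On v v′ t P → t ≤ n
  On-≤ src             = z≤n
  On-≤ tgt             = ≤-refl
  On-≤ (mid t _ _ t<n) = <⇒≤ t<n

  point : ∀ v v′ → .(v ∼ v′) → ℕ → Point
  point v v′ a zero = orig v
  point v v′ a (suc t) with suc t <? n
  ... | yes lt = inn v v′ a (suc t) lt
  ... | no _   = orig v′

  point-On : ∀ {v v′} .(a : v ∼ v′) t → t ≤ n → On v v′ t (point v v′ a t)
  point-On a zero    le = src
  point-On a (suc t) le with suc t <? n
  ... | yes lt = mid (suc t) (s≤s z≤n) a lt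
  ... | no ≮   with refl ← ≤-antisym le (≮⇒≥ ≮) = tgt

  point-tgt : ∀ {v v′} .(a : v ∼ v′) → 0 < n → point v v′ a n ≡ orig v′
  point-tgt a 0<n = end n 0<n ≤-refl
    where
    end : ∀ {v v′} .{a : v ∼ v′} t → 0 < t → n ≤ t → point v v′ a t ≡ orig v′
    end (suc t) _ n≤t with suc t <? n
    ... | yes lt = contradiction n≤t (<⇒≱ lt)
    ... | no _   = refl

  path : ∀ {v v′} (a : v ∼ v′) d t → d + t ≤ n → Walk Ŝ d (point v v′ a t) (point v v′ a (d + t))
  path a zero    t le = []
  path {v} {v′} a (suc d) t le =
    (v , v′ , a , t , inj₁ (point-On a t (<⇒≤ lt) , point-On a (suc t) lt)) ∷
    subst (λ s → Walk Ŝ d (point v v′ a (suc t)) (point v v′ a s)) (+-suc d t) (path a d (suc t) (subst (_≤ n) (sym (+-suc d t)) le))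
    where
    lt : suc t ≤ n
    lt = ≤-trans (s≤s (m≤n+m t d)) le

par : ℕ → Bool
par zero    = false
par (suc n) = not (par n)

par-+ : ∀ m n → par (m + n) ≡ par m xor par n
par-+ zero    n = refl
par-+ (suc m) n = trans (cong not (par-+ m n)) (not-distribˡ-xor (par m) (par n))

par-odd : ∀ {n} → Odd n → par n ≡ true
par-odd (i , refl) = cong not (trans (cong (λ j → par (i + j)) (+-identityʳ i)) (trans (par-+ i i) (xor-same (par i))))

pick : ∀ {A : Set} → ℕ → A → A → A
pick t a b = if par t then b else a

pick-flip : ∀ {A : Set} t d (a b : A) → par (t + d) ≡ true → pick d b a ≡ pick t a b
pick-flip t d a b eq with par t | par d | trans (sym (par-+ t d)) eq
... | true  | false | _ = refl
... | false | true  | _ = refl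

pick-adjacent : ∀ {A : Set} (R : A → A → Set) {z x y} i j → R x z → R z y → par (i + j) ≡ true → R (pick i z x) (pick j z y)
pick-adjacent R i j xz zy eq with par i | par j | trans (sym (par-+ i j)) eq
... | true  | false | _ = xz
... | false | true  | _ = zy

-- Moving each point of an edge z z′ to z or z′ according to parity sends walks of
-- length e to edges: such a walk stays on one edge, or runs through one vertex.

module Collapse (Z : Graph) (Z-sym : Sym Z) (e : ℕ) (e-odd : Odd e) where

  open Paths Z e

  private
    infix 4 _∼_
    _∼_ = _~_ Z
    0<e : 0 < e
    0<e = subst (0 <_) (sym (proj₂ e-odd)) (s≤s z≤n)

  collapse : Point → V Z
  collapse (orig z)         = z
  collapse (inn z z′ _ t _) = pick t z z′

  -- An edge carries two paths, one for each orientation. Recording the distances to both ends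
  -- treats them alike; as e is odd, these have opposite parities and `collapse` has one formula for
  -- both.
  record OnU (z z′ : V Z) (t d : ℕ) (P : Point) : Set where
    constructor onU
    field
      adjacent : z ∼ z′
      total    : t + d ≡ e
      on       : On z z′ t P ⊎ On z′ z d P
  open OnU

  flipU : ∀ {z z′ t d P} → OnU z z′ t d P → OnU z′ z d t P
  flipU {z} {z′} {t} {d} (onU a tot o) = onU (Z-sym z z′ a) (trans (+-comm d t) tot) (Sum.swap o)

  collapse-On : ∀ {z z′ t P} → On z z′ t P → collapse P ≡ pick t z z′
  collapse-On src = refl
  collapse-On {z} {z′} tgt = sym (cong (λ b → if b then z′ else z) (par-odd e-odd))
  collapse-On (mid t _ _ _) = refl

  collapse-OnU : ∀ {z z′ t d P} → OnU z z′ t d P → collapse P ≡ pick t z z′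
  collapse-OnU (onU _ _ (inj₁ o)) = collapse-On o
  collapse-OnU {z} {z′} {t} {d} (onU _ tot (inj₂ o)) =
    trans (collapse-On o) (pick-flip t d z z′ (trans (cong par tot) (par-odd e-odd)))

  step-forward : ∀ {P Q} → Step P Q → ∃ λ z → ∃ λ z′ → ∃ λ t → ∃ λ d → OnU z z′ t (suc d) P × OnU z z′ (suc t) d Q
  step-forward (z , z′ , a , t , inj₁ (p , q)) with m≤n⇒∃[o]m+o≡n (On-≤ q)
  ... | d , tot = z , z′ , t , d , onU a (trans (+-suc t d) tot) (inj₁ p) , onU a tot (inj₁ q)
  step-forward (z , z′ , a , t , inj₂ (p , q)) with m≤n⇒∃[o]m+o≡n (On-≤ p)
  ... | d , tot = z′ , z , d , t ,
    onU (Z-sym _ _ a) (trans (+-comm d (suc t)) tot) (inj₂ p) ,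
    onU (Z-sym _ _ a) (trans (+-comm (suc d) t) (trans (+-suc t d) tot)) (inj₂ q)

  at-orig : ∀ {z z′ t d v} → OnU z z′ t d (orig v) → (t ≡ 0 × z ≡ v) ⊎ (d ≡ 0 × z′ ≡ v)
  at-orig (onU _ tot (inj₁ src)) = inj₁ (refl , refl)
  at-orig {d = d} (onU _ tot (inj₁ tgt)) = inj₂ (+-cancelˡ-≡ e d 0 (trans tot (sym (+-identityʳ e))) , refl)
  at-orig (onU _ tot (inj₂ src)) = inj₂ (refl , refl)
  at-orig {t = t} (onU _ tot (inj₂ tgt)) = inj₁ (+-cancelʳ-≡ e t 0 tot , refl)

  at-inn : ∀ {z z′ t d v v′ s} .{a : v ∼ v′} .{lt : s < e} → OnU z z′ t d (inn v v′ a s lt) →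
    (z ≡ v × z′ ≡ v′ × t ≡ s) ⊎ (z ≡ v′ × z′ ≡ v × d ≡ s)
  at-inn (onU _ _ (inj₁ (mid _ _ _ _))) = inj₁ (refl , refl , refl)
  at-inn (onU _ _ (inj₂ (mid _ _ _ _))) = inj₂ (refl , refl , refl)

  data Moves (z z′ : V Z) : ℕ → ℕ → Point → Set where
    ahead : ∀ {t d Q} → OnU z z′ (suc t) d Q → Moves z z′ t (suc d) Q
    back  : ∀ {t d Q} → OnU z z′ t (suc d) Q → Moves z z′ (suc t) d Q
    leave : ∀ {d y c Q} → OnU z y 1 c Q → Moves z z′ 0 d Q
    enter : ∀ {t y c Q} → OnU z′ y 1 c Q → Moves z z′ t 0 Q

  moves : ∀ {z z′ t d P Q} → OnU z z′ t d P → Step P Q → Moves z z′ t d Q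
  moves {P = P} p s with step-forward s
  moves {P = orig v} p s | y , y′ , i , c , q , q′ with at-orig p | at-orig q
  ... | inj₁ (refl , refl) | inj₁ (refl , refl) = leave q′
  ... | inj₂ (refl , refl) | inj₁ (refl , refl) = enter q′
  moves {P = inn v v′ a r lt} p s | y , y′ , i , c , q , q′ with at-inn p | at-inn q
  ... | inj₁ (refl , refl , refl) | inj₁ (refl , refl , refl)
      with refl ← +-cancelˡ-≡ r _ _ (trans (total p) (sym (total q))) = ahead q′
  ... | inj₂ (refl , refl , refl) | inj₂ (refl , refl , refl)
      with refl ← +-cancelʳ-≡ (suc c) _ _ (trans (total p) (sym (total q))) = ahead q′
  ... | inj₁ (refl , refl , refl) | inj₂ (refl , refl , refl)
      with refl ← +-cancelˡ-≡ (suc c) _ _ (trans (total p) (trans (sym (total q)) (+-comm i (suc c)))) = back (flipU q′)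
  ... | inj₂ (refl , refl , refl) | inj₁ (refl , refl , refl)
      with refl ← +-cancelʳ-≡ r _ _ (trans (total p) (trans (sym (total q)) (+-comm r (suc c)))) = back (flipU q′)

  -- Invariant of a walk of length n ≤ e: it has stayed on one edge, possibly turning back, or the
  -- ends lie on edges at a common vertex z, at distances i and j from it. The parity of n decides
  -- where `collapse` sends the ends.
  data Reach (P : Point) (n : ℕ) (Q : Point) : Set where
    within  : ∀ {z z′ t d s c} → OnU z z′ t d P → OnU z z′ s c Q →
              s ≤ t + n → t ≤ s + n → par (t + s) ≡ par n → Reach P n Q
    through : ∀ {z x y i i′ j j′} → OnU z x i i′ P → OnU z y j j′ Q →
              i + j ≤ n → par (i + j) ≡ par n → Reach P n Q

  private
    par-up : ∀ {t s n} → par (t + s) ≡ par n → par (t + suc s) ≡ par (suc n)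
    par-up {t} {s} eq = trans (cong par (+-suc t s)) (cong not eq)
    par-down : ∀ {t s n} → par (t + suc s) ≡ par n → par (t + s) ≡ par (suc n)
    par-down {t} {s} {n} eq = not-injective (trans (trans (cong par (sym (+-suc t s))) eq) (sym (not-involutive (par n))))
    par-double : ∀ t d → par (t + (t + d)) ≡ par d
    par-double t d = trans (par-+ t (t + d)) (trans (cong (par t xor_) (par-+ t d)) (xor-cancelˡ (par t) (par d)))

  reach-step : ∀ {P Q R n} → n < e → Reach P n Q → Step Q R → Reach P (suc n) R
  reach-step {n = n} n<e (within {t = t} {d} {s} p q s≤ t≤ eq) st with moves q st
  ... | ahead r = within p r (subst (suc s ≤_) (sym (+-suc t n)) (s≤s s≤)) (≤-trans t≤ (+-mono-≤ (n≤1+n s) (n≤1+n n))) (par-up {t} {n = n} eq)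
  ... | back {t = s′} r = within p r (≤-trans (n≤1+n s′) (≤-trans s≤ (+-monoʳ-≤ t (n≤1+n n)))) (subst (t ≤_) (sym (+-suc s′ n)) t≤) (par-down {t} {n = n} eq)
  ... | leave r = through p r (subst (_≤ suc n) (+-comm 1 t) (s≤s t≤)) (par-up {t} {n = n} eq)
  -- Here s = e, so the start is at distance d = s - t from the vertex z′ being passed.
  ... | enter r = through (flipU p) r (subst (_≤ suc n) (+-comm 1 d) (s≤s d≤n)) (par-up {d} {n = n} (trans (cong par (+-identityʳ d)) (trans (sym (par-double t d)) (trans (cong (λ m → par (t + m)) (trans (total p) (trans (sym (total q)) (+-identityʳ s)))) eq))))
    where
    d≤n : d ≤ n
    d≤n = +-cancelˡ-≤ t d n (≤-trans (≤-reflexive (trans (total p) (trans (sym (total q)) (+-identityʳ s)))) s≤)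
  reach-step {n = n} n<e (through {i = i} {j = j} p q i+j≤ eq) st with moves q st
  ... | ahead r = through p r (subst (_≤ suc n) (sym (+-suc i j)) (s≤s i+j≤)) (par-up {i} {n = n} eq)
  ... | back {t = j′} r = through p r (≤-trans (+-monoʳ-≤ i (n≤1+n j′)) (m≤n⇒m≤1+n i+j≤)) (par-down {i} {n = n} eq)
  ... | leave r = through p r (subst (_≤ suc n) (sym (+-suc i 0)) (s≤s i+j≤)) (par-up {i} {n = n} eq)
  -- The far end of the second edge is out of reach: it would have j = e > n.
  ... | enter r = contradiction (≤-trans (≤-reflexive (trans (sym (total q)) (+-identityʳ j))) (≤-trans (m≤n+m j i) i+j≤)) (<⇒≱ n<e)

  reach-walk : ∀ {P Q R} n t → n + t ≡ e → Reach P n Q → Walk Ŝ t Q R → Reach P e R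
  reach-walk n zero    eq r [] = subst (λ m → Reach _ m _) (trans (sym (+-identityʳ n)) eq) r
  reach-walk n (suc t) eq r (s ∷ w) =
    reach-walk (suc n) t eq′ (reach-step (subst (n <_) eq′ (s≤s (m≤m+n n t))) r s) w
    where
    eq′ : suc n + t ≡ e
    eq′ = trans (sym (+-suc n t)) eq

  collapse-walk : ∀ {P Q} → Walk Ŝ e P Q → collapse P ∼ collapse Q
  collapse-walk {P} {Q} w with start e 0<e w
    where
    start : ∀ t → 0 < t → Walk Ŝ t P Q → ∃ λ z → ∃ λ z′ → ∃ λ s → ∃ λ c → OnU z z′ s c P
    start (suc t) _ (s ∷ _) with z , z′ , i , c , p , _ ← step-forward s = z , z′ , i , suc c , p
  ... | z , z′ , s , c , p with reach-walk 0 e refl (within p p (≤-reflexive (sym (+-identityʳ s))) (≤-reflexive (sym (+-identityʳ s))) parity) w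
    where
    parity : par (s + s) ≡ false
    parity = trans (cong (λ m → par (s + m)) (sym (+-identityʳ s))) (par-double s 0)
  ... | within {t = t} {s = r} p q _ _ eq = subst₂ _∼_ (sym (collapse-OnU p)) (sym (collapse-OnU q))
        (pick-adjacent _∼_ t r (Z-sym _ _ (adjacent p)) (adjacent q) (trans eq (par-odd e-odd)))
  ... | through {i = i} {j = j} p q _ eq = subst₂ _∼_ (sym (collapse-OnU p)) (sym (collapse-OnU q))
        (pick-adjacent _∼_ i j (Z-sym _ _ (adjacent p)) (adjacent q) (trans eq (par-odd e-odd)))

-- Coarsening a fine subdivision

Subdivide-sym : ∀ G key n → Sym (Subdivide G key n)
Subdivide-sym G key n x y (e , i , s) = e , i , Sum.swap (Sum.map swap swap s)

quotient : ∀ e .{{_ : NonZero e}} q ρ → ρ < e → (q * e + ρ) / e ≡ q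
quotient e q ρ ρ<e = trans (+-distrib-/-∣ˡ ρ (n∣m*n q)) (trans (cong₂ _+_ (m*n/n≡m q e) (m<n⇒m/n≡0 ρ<e)) (+-identityʳ q))

remainder : ∀ e .{{_ : NonZero e}} q ρ → ρ < e → (q * e + ρ) % e ≡ ρ
remainder e q ρ ρ<e = trans (cong (_% e) (+-comm (q * e) ρ)) (trans ([m+kn]%n≡m%n ρ q e) (m<n⇒m%n≡m ρ<e))

-- Cutting each of the w parts of an edge of X into e gives w e parts. Collapsing those pieces turns
-- walks of length u e in the fine subdivision into walks of length u in `Subdivide X key w`.
module Coarse (X : Graph) (X-sym : Sym X) (key : V X → ℕ) (key-distinct : ∀ {v v′} → _~_ X v v′ → key v ≢ key v′)
  (w : ℕ) (0<w : 0 < w) (e : ℕ) (e-odd : Odd e) where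

  private
    infix 4 _∼_
    _∼_ = _~_ X
    Z : Graph
    Z = Subdivide X key w
    Z-sym = Subdivide-sym X key w
    module PX = Paths X (w * e)
    module PZ = Paths Z e
    0<e : 0 < e
    0<e = subst (0 <_) (sym (proj₂ e-odd)) (s≤s z≤n)
    instance
      e-nonZero : NonZero e
      e-nonZero = >-nonZero 0<e

  Ordering : V X → V X → Set
  Ordering v v′ = Tri (key v < key v′) (key v ≡ key v′) (key v′ < key v)

  -- `Subdivide` has only the path that starts at the smaller key; from the larger key it is run
  -- backwards. Adjacent vertices have different keys, so the value for equal keys is a placeholder.
  onEdge : ∀ v v′ → .(v ∼ v′) → Ordering v v′ → ℕ → V Z
  onEdge v v′ a o zero = orig v
  onEdge v v′ a o (suc q) with suc q <? w
  onEdge v v′ a o             (suc q) | no _   = orig v′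
  onEdge v v′ a (tri< k< _ _) (suc q) | yes lt = inner (edge v v′ k< [ a ]) (suc q) (s≤s z≤n) lt
  onEdge v v′ a (tri≈ _ _ _)  (suc q) | yes lt = orig v
  onEdge v v′ a (tri> _ _ k>) (suc q) | yes lt =
    inner (edge v′ v k> [ X-sym v v′ a ]) (w ∸ suc q) (m<n⇒0<n∸m lt) (∸-monoʳ-< {w} {suc q} {0} (s≤s z≤n) (<⇒≤ lt))

  onEdge-adj : ∀ {v v′} (a : v ∼ v′) o q → suc q ≤ w → _~_ Z (onEdge v v′ a o q) (onEdge v v′ a o (suc q))
  onEdge-adj a (tri≈ _ k≡ _) q lt = ⊥-elim (key-distinct a k≡)
  onEdge-adj {v} {v′} a o@(tri< k< _ _) q lt = E , q , inj₁ (at q (<⇒≤ lt) , at (suc q) lt)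
    where
    E = edge v v′ k< [ a ]
    at : ∀ q → q ≤ w → At X key w E q (onEdge v v′ a o q)
    at zero    _  = atSrc
    at (suc q) le with suc q <? w
    ... | yes lt = atIn (suc q) (s≤s z≤n) lt
    ... | no ≮   = subst (λ i → At X key w E i (orig v′)) (sym (≤-antisym le (≮⇒≥ ≮))) atTgt
  onEdge-adj {v} {v′} a o@(tri> _ _ k>) q lt =
    E , w ∸ suc q , inj₂ (subst (λ i → At X key w E i (onEdge v v′ a o q)) (+-∸-assoc 1 lt) (at q (<⇒≤ lt)) , at (suc q) lt)
    where
    E = edge v′ v k> [ X-sym v v′ a ]
    at : ∀ q → q ≤ w → At X key w E (w ∸ q) (onEdge v v′ a o q)
    at zero    _  = atTgt
    at (suc q) le with suc q <? w
    ... | yes lt = atIn (w ∸ suc q) (m<n⇒0<n∸m lt) (∸-monoʳ-< {w} {suc q} {0} (s≤s z≤n) (<⇒≤ lt))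
    ... | no ≮   = subst (λ i → At X key w E i (orig v′)) (sym (m≤n⇒m∸n≡0 (≮⇒≥ ≮))) atSrc

  subPoint : ∀ v v′ → .(v ∼ v′) → ℕ → V Z
  subPoint v v′ a = onEdge v v′ a (<-cmp (key v) (key v′))

  subPoint-end : ∀ {v v′} .{a : v ∼ v′} → subPoint v v′ a w ≡ orig v′
  subPoint-end {v} {v′} {a} = go w 0<w ≤-refl
    where
    go : ∀ q → 0 < q → w ≤ q → subPoint v v′ a q ≡ orig v′
    go (suc q) _ w≤q with suc q <? w
    ... | yes lt = contradiction w≤q (<⇒≱ lt)
    ... | no _   = refl

  subPoint-adj : ∀ {v v′} (a : v ∼ v′) q → suc q ≤ w → _~_ Z (subPoint v v′ a q) (subPoint v v′ a (suc q))
  subPoint-adj {v} {v′} a = onEdge-adj a (<-cmp (key v) (key v′))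

  refine : PX.Point → PZ.Point
  refine (PX.orig v) = PZ.orig (orig v)
  refine (PX.inn v v′ a T T<) =
    PZ.point (subPoint v v′ a (T / e)) (subPoint v v′ a (suc (T / e))) (subPoint-adj a (T / e) (m<n*o⇒m/o<n T<)) (T % e)

  -- The case ρ = e is included because the upper point of a step may end a small piece; division
  -- then places it at the start of the next one, which is the same vertex.
  refine-On : ∀ {v v′} (a : v ∼ v′) {T P} → PX.On v v′ T P → ∀ q ρ → q * e + ρ ≡ T → ρ ≤ e → suc q ≤ w →
    PZ.On (subPoint v v′ a q) (subPoint v v′ a (suc q)) ρ (refine P)
  refine-On a PX.src zero zero eq ρ≤ q< = PZ.src
  refine-On a PX.src (suc q) ρ eq ρ≤ q< = ⊥-elim (<⇒≢ 0<e (sym (m+n≡0⇒m≡0 e (m+n≡0⇒m≡0 (e + q * e) eq))))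
  refine-On {v} {v′} a PX.tgt q ρ eq ρ≤ q< =
    subst₂ (λ r z → PZ.On (subPoint v v′ a q) (subPoint v v′ a (suc q)) r (PZ.orig z)) ρ≡
      (trans (cong (subPoint v v′ a) end) subPoint-end) PZ.tgt
    where
    end : suc q ≡ w
    end = ≤-antisym q< (*-cancelʳ-≤ w (suc q) e (≤-trans (≤-reflexive (sym eq)) (≤-trans (+-monoʳ-≤ (q * e) ρ≤) (≤-reflexive (+-comm (q * e) e)))))
    ρ≡ : e ≡ ρ
    ρ≡ = +-cancelˡ-≡ (q * e) e ρ (trans (+-comm (q * e) e) (trans (cong (_* e) end) (sym eq)))
  refine-On {v} {v′} a (PX.mid T _ _ T<) q ρ refl ρ≤ q< with ρ <? e
  ... | yes ρ< = place (T / e) (T % e) _ (quotient e q ρ ρ<) (remainder e q ρ ρ<)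
    where
    place : ∀ q′ ρ′ .b → q′ ≡ q → ρ′ ≡ ρ →
      PZ.On (subPoint v v′ a q) (subPoint v v′ a (suc q)) ρ (PZ.point (subPoint v v′ a q′) (subPoint v v′ a (suc q′)) b ρ′)
    place _ _ b refl refl = PZ.point-On b ρ ρ≤
  ... | no ≮ with refl ← ≤-antisym ρ≤ (≮⇒≥ ≮) = place (T / e) (T % e) _
      (trans (cong (_/ e) shift) (quotient e (suc q) 0 0<e)) (trans (cong (_% e) shift) (remainder e (suc q) 0 0<e))
    where
    shift : q * e + e ≡ suc q * e + 0
    shift = trans (+-comm (q * e) e) (sym (+-identityʳ _))
    place : ∀ q′ ρ′ .b → q′ ≡ suc q → ρ′ ≡ 0 →
      PZ.On (subPoint v v′ a q) (subPoint v v′ a (suc q)) e (PZ.point (subPoint v v′ a q′) (subPoint v v′ a (suc q′)) b ρ′)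
    place _ _ b refl refl = PZ.tgt

  refine-hom : Hom PX.Ŝ PZ.Ŝ refine
  refine-hom P Q (v , v′ , a , T , s) = subPoint v v′ a q , subPoint v v′ a (suc q) , subPoint-adj a q q< , ρ , locate s
    where
    q = T / e
    ρ = T % e
    T≡ : q * e + ρ ≡ T
    T≡ = trans (+-comm (q * e) ρ) (sym (m≡m%n+[m/n]*n T e))
    ρ< : ρ < e
    ρ< = m%n<n T e
    bound : (PX.On v v′ T P × PX.On v v′ (suc T) Q) ⊎ (PX.On v v′ (suc T) P × PX.On v v′ T Q) → T < w * e
    bound (inj₁ (_ , o)) = PX.On-≤ o
    bound (inj₂ (o , _)) = PX.On-≤ o
    q< : suc q ≤ w
    q< = m<n*o⇒m/o<n (bound s)
    here′ : ∀ {R} → PX.On v v′ T R → PZ.On (subPoint v v′ a q) (subPoint v v′ a (suc q)) ρ (refine R)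
    here′ o = refine-On a o q ρ T≡ (<⇒≤ ρ<) q<
    next : ∀ {R} → PX.On v v′ (suc T) R → PZ.On (subPoint v v′ a q) (subPoint v v′ a (suc q)) (suc ρ) (refine R)
    next o = refine-On a o q (suc ρ) (trans (+-suc (q * e) ρ) (cong suc T≡)) ρ< q<
    locate : (PX.On v v′ T P × PX.On v v′ (suc T) Q) ⊎ (PX.On v v′ (suc T) P × PX.On v v′ T Q) → _
    locate (inj₁ (p , r)) = inj₁ (here′ p , next r)
    locate (inj₂ (p , r)) = inj₂ (next p , here′ r)

  open Collapse Z Z-sym e e-odd

  coarse : PX.Point → V Z
  coarse P = collapse (refine P)

  coarse-walk : ∀ u {P Q} → Walk PX.Ŝ (u * e) P Q → Walk Z u (coarse P) (coarse Q)
  coarse-walk u p = walk-map {f = coarse} (λ _ _ q → collapse-walk (walk-map refine-hom q)) (power-walk e u p)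

-- Keys and universality

bit : Bool → ℕ
bit b = if b then 1 else 0

bitsToℕ-injective : ∀ {n} (xs ys : Vec Bool n) → bitsToℕ (toList xs) ≡ bitsToℕ (toList ys) → xs ≡ ys
bitsToℕ-injective []       []       eq = refl
bitsToℕ-injective (x ∷ xs) (y ∷ ys) eq = cong₂ _∷_ (proj₁ both) (bitsToℕ-injective xs ys (proj₂ both))
  where
  split : ∀ x y a b → bit x + 2 * a ≡ bit y + 2 * b → x ≡ y × a ≡ b
  split true  true  a b eq = refl , *-cancelˡ-≡ a b 2 (suc-injective eq)
  split false false a b eq = refl , *-cancelˡ-≡ a b 2 eq
  split true  false a b eq = ⊥-elim (even≢odd b a (sym eq))
  split false true  a b eq = ⊥-elim (even≢odd a b eq)
  both : x ≡ y × bitsToℕ (toList xs) ≡ bitsToℕ (toList ys)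
  both = split x y _ _ eq

concat-injective : ∀ {A : Set} {m n} (xs ys : Vec (Vec A m) n) → concat xs ≡ concat ys → xs ≡ ys
concat-injective []       []       eq = refl
concat-injective (x ∷ xs) (y ∷ ys) eq with p , q ← ++-injective x y eq = cong₂ _∷_ p (concat-injective xs ys q)

hkey-injective : ∀ {m n k} (A B : HVertex m n k) → hkey A ≡ hkey B → A ≡ B
hkey-injective (hv A _) (hv B _) eq with refl ← concat-injective A B (bitsToℕ-injective (concat A) (concat B) eq) = refl

-- Excluded middle, used once for each element of the list; enough when the goal is a contradiction.
¬¬-decidable : ∀ {A : Set} {P : A → Set} (xs : List A) → ¬ ¬ (∀ {x} → x ∈ xs → Dec (P x))
¬¬-decidable []       k = k λ ()
¬¬-decidable (x ∷ xs) k = ¬¬-excluded-middle λ px → ¬¬-decidable xs λ pxs → k λ { (here refl) → px ; (there x∈) → pxs x∈ }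

Linked : (G : Graph) → V G → Set
Linked G P = ∃ λ Q → _~_ G P Q

linked-walk : ∀ {G} → Sym G → ∀ n {P} → Linked G P → ∃ λ Q → Walk G n P Q
linked-walk G-sym zero    _            = _ , []
linked-walk G-sym (suc n) {P} (P′ , st) with Q , p ← linked-walk G-sym n (P , G-sym P P′ st) = Q , st ∷ p

walk-linked : ∀ {G n P Q} → Odd n → Walk G n P Q → Linked G P
walk-linked (_ , refl) (st ∷ _) = _ , st

-- H(m,1,k) is universal: a colouring c of S that separates the ends of every odd
-- walk of length at most (2k−1)q sends q-walks in S to edges of H(m,1,k).

module Universal (m k′ : ℕ) (S : Graph) (S-sym : Sym S) (q : ℕ) (q-odd : Odd q) (c : V S → Fin m)
  (c-wide : ∀ {n P Q} → Odd n → n ≤ suc (2 * k′) * q → Walk S n P Q → c P ≢ c Q) where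

  private
    k : ℕ
    k = suc k′
    H : Graph
    H = Helical m 1 k

  -- The (i+1)-st set of the image of P consists of the colours at the ends of walks of length i q.
  -- With i < k included, the question is settled at once for all larger i.
  Seen : V S → ℕ → Fin m → Set
  Seen P i x = i < k × ∃ λ Q → Walk S (i * q) P Q × c Q ≡ x

  module WithDecisions (seen? : ∀ P i x → Dec (Seen P i x)) where

    open Sequences m k

    seen : V S → ℕ → Subset m
    seen P i = subset (seen? P i)

    ∈-seen⁺ : ∀ {P i Q} → i < k → Walk S (i * q) P Q → c Q ∈ˢ seen P i
    ∈-seen⁺ {P} {i} {Q} i<k p = ∈-subset⁺ (seen? P i) (i<k , Q , p , refl)

    ∈-seen⁻ : ∀ {P i x} → x ∈ˢ seen P i → ∃ λ Q → Walk S (i * q) P Q × c Q ≡ x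
    ∈-seen⁻ {P} {i} x∈ = proj₂ (∈-subset⁻ (seen? P i) x∈)

    around : ∀ i q → i * q + (q + i * q) ≡ suc (2 * i) * q
    around = solve-∀

    -- The length is (2i + 1) q, which is odd and at most (2k - 1) q. This gives both disjointness
    -- conditions, within a vertex and across an edge.
    separated : ∀ i → i < k → ∀ {Q Q′} → Walk S (i * q + (q + i * q)) Q Q′ → c Q ≢ c Q′
    separated i (s≤s i≤) p = c-wide (odd-* (i , refl) q-odd) (*-monoˡ-≤ q (s≤s (*-monoʳ-≤ 2 i≤))) (walk-length (around i q) p)

    seen-seq : ∀ {P} → Linked S P → Seq (seen P)
    seen-seq {P} linked = record
      { single   = c P , ⊆-antisym below above
      ; nonempty = λ i i<k → _ , ∈-seen⁺ i<k (proj₂ (linked-walk S-sym (i * q) linked))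
      ; disjoint = λ i i<k → disjoint i (<⇒≤ i<k)
      ; mono     = mono
      }
      where
      below : seen P 0 ⊆ ⁅ c P ⁆
      below x∈ with Q , [] , refl ← ∈-seen⁻ {P} {0} x∈ = x∈⁅x⁆ _
      above : ⁅ c P ⁆ ⊆ seen P 0
      above x∈ with refl ← x∈⁅y⁆⇒x≡y _ x∈ = ∈-seen⁺ (s≤s z≤n) []
      disjoint : ∀ i → i < k → ∀ {x} → x ∈ˢ seen P i → x ∈ˢ seen P (suc i) → ⊥
      disjoint i i<k x∈ x∈′ with Q , p , refl ← ∈-seen⁻ {P} {i} x∈ | Q′ , p′ , eq ← ∈-seen⁻ {P} {suc i} x∈′
        = separated i i<k (walk-reverse S-sym p ▹▹ p′) (sym eq)
      twice : ∀ i q → 2 * q + i * q ≡ q + (q + i * q)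
      twice = solve-∀
      mono : ∀ i → 2 + i < k → ∀ {x} → x ∈ˢ seen P i → x ∈ˢ seen P (2 + i)
      -- Going to and fro q times on an edge at P adds the missing 2q steps.
      mono i lt x∈ with Q , p , refl ← ∈-seen⁻ {P} {i} x∈ =
        ∈-seen⁺ lt (walk-length (twice i q) (walk-pad S-sym q (proj₂ linked) p))

    image : ∀ P → .(Linked S P) → V H
    image P linked = vertex (seen P) (seen-seq linked)

    image-adj : ∀ {P P′} .(l : Linked S P) .(l′ : Linked S P′) → Walk S q P P′ → _~_ H (image P l) (image P′ l′)
    image-adj {P} {P′} l l′ p = sets-adj (seen P) (seen P′) (helical (seen-seq l)) (helical (seen-seq l′))
      disjoint λ i i<k → inc i i<k p , inc i i<k (walk-reverse S-sym p)
      where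
      disjoint : ∀ i → i < k → ∀ {x} → x ∈ˢ seen P i → x ∈ˢ seen P′ i → ⊥
      disjoint i i<k x∈ x∈′ with Q , r , refl ← ∈-seen⁻ {P} {i} x∈ | Q′ , r′ , eq ← ∈-seen⁻ {P′} {i} x∈′
        = separated i i<k (walk-reverse S-sym r ▹▹ (p ▹▹ r′)) (sym eq)
      inc : ∀ i → suc i < k → ∀ {R R′ x} → Walk S q R R′ → x ∈ˢ seen R i → x ∈ˢ seen R′ (suc i)
      inc i lt {R} p x∈ with Q , r , refl ← ∈-seen⁻ {R} {i} x∈ = ∈-seen⁺ lt (walk-reverse S-sym p ▹▹ r)

    image-walk : ∀ n {P Q} .(l : Linked S P) .(l′ : Linked S Q) → Walk S (n * q) P Q → Walk H n (image P l) (image Q l′)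
    image-walk zero    l l′ [] = []
    image-walk (suc n) {P} {Q} l l′ p with R , p₁ , p₂ ← walk-split q p =
      image-adj l (linked p₁) p₁ ∷ image-walk n (linked p₁) l′ p₂
      where
      linked : ∀ {R} → Walk S q P R → Linked S R
      linked p₁ = walk-linked q-odd (walk-reverse S-sym p₁)

-- No finite non-bipartite graph X admits a homomorphism X^{(N+2)/N} → X.

module Stretching (X : Graph) (X-irrefl : ∀ v → ¬ _~_ X v v) (X-sym : Sym X)
  (_≟_ : ∀ (u v : V X) → Dec (u ≡ v)) (vs : List (V X)) (∈-vs : ∀ v → v ∈ vs)
  (adj? : ∀ u v → Dec (_~_ X u v)) (N : ℕ) (N-odd : Odd N) where

  open Paths X N

  0<N : 0 < N
  0<N = subst (0 <_) (sym (proj₂ N-odd)) (s≤s z≤n)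

  innerPoints : (V X × V X) × Fin N → List Point
  innerPoints ((A , B) , t) with adj? A B
  ... | yes a = inn A B a (toℕ t) (Fin.toℕ<n t) ∷ []
  ... | no _  = []

  points : List Point
  points = map orig vs ++ concatMap innerPoints (cartesianProduct (cartesianProduct vs vs) (allFin N))

  ∈-points : ∀ P → P ∈ points
  ∈-points (orig A) = ∈-++⁺ˡ (∈-map⁺ orig (∈-vs A))
  ∈-points (inn A B a t t<) = ∈-++⁺ʳ (map orig vs) (∈-concatMap⁺ innerPoints
    (lose (∈-cartesianProduct⁺ (∈-cartesianProduct⁺ (∈-vs A) (∈-vs B)) (∈-allFin i)) inner∈))
    where
    t<N : t < N
    t<N = recompute (t <? N) t<
    i : Fin N
    i = fromℕ< t<N
    same : ∀ {t′} .(t′< : t′ < N) → t′ ≡ t → inn A B a t t< ≡ inn A B a t′ t′<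
    same _ refl = refl
    inner∈ : inn A B a t t< ∈ innerPoints ((A , B) , i)
    inner∈ with adj? A B
    ... | yes _  = here (same (Fin.toℕ<n i) (Fin.toℕ-fromℕ< t<N))
    ... | no ¬a = contradiction (recompute (adj? A B) a) ¬a

  On-linked : ∀ {v v′ t P} → _~_ X v v′ → On v v′ t P → Linked Ŝ P
  On-linked {v} {v′} {zero}  a o = _ , v , v′ , a , 0 , inj₁ (o , point-On a 1 0<N)
  On-linked {v} {v′} {suc t} a o = _ , v , v′ , a , t , inj₂ (o , point-On a t (<⇒≤ (On-≤ o)))

  point-linked : ∀ {v v′} (a : _~_ X v v′) t → Linked Ŝ (point v v′ a t)
  point-linked a zero = On-linked a src
  point-linked a (suc t) with suc t <? N
  ... | yes lt = On-linked a (mid (suc t) (s≤s z≤n) a lt)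
  ... | no _   = On-linked a tgt

  module _ (F : ∀ P → .(Linked Ŝ P) → V X)
    (F-hom : ∀ {n P Q} .(l : Linked Ŝ P) .(l′ : Linked Ŝ Q) → Odd n → n ≤ 2 + N → Walk Ŝ n P Q → _~_ X (F P l) (F Q l′)) where

    F-cong : ∀ {P P′} .{l : Linked Ŝ P} .{l′ : Linked Ŝ P′} → P ≡ P′ → F P l ≡ F P′ l′
    F-cong refl = refl

    2+N-odd : Odd (2 + N)
    2+N-odd = suc (proj₁ N-odd) , trans (cong (2 +_) (proj₂ N-odd)) (cong suc (sym (*-suc 2 (proj₁ N-odd))))

    nbr? : ∀ A → Dec (∃ λ B → _~_ X A B)
    nbr? A = map′ (λ any → Any.lookup any , lookup-result any) (λ { (B , p) → lose (∈-vs B) p }) (Any.any? (adj? A) vs)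

    f : V X → V X → ℕ → V X
    f A B t with adj? A B
    ... | yes a = F (point A B a t) (point-linked a t)
    ... | no _  = A

    f-point : ∀ {A B} (a : _~_ X A B) t → f A B t ≡ F (point A B a t) (point-linked a t)
    f-point {A} {B} a t with adj? A B
    ... | yes _  = refl
    ... | no ¬a = contradiction a ¬a

    h : V X → V X
    h A with nbr? A
    ... | yes (B , a) = F (orig A) (point-linked a 0)
    ... | no _        = A

    h-orig : ∀ {A B} (a : _~_ X A B) → h A ≡ F (orig A) (point-linked a 0)
    h-orig {A} {B} a with nbr? A
    ... | yes _  = refl
    ... | no ¬a = contradiction (B , a) ¬a

    across : ∀ {A B} (a : _~_ X A B) → Walk Ŝ N (orig A) (orig B)
    across {A} {B} a = subst (Walk Ŝ N (orig A)) (trans (cong (point A B a) (+-identityʳ N)) (point-tgt a 0<N))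
      (path a N 0 (≤-reflexive (+-identityʳ N)))

    down : ∀ {A B} (a : _~_ X A B) t → t ≤ N → Walk Ŝ t (point A B a t) (orig A)
    down {A} {B} a t t≤ = walk-reverse Step-sym (subst (λ i → Walk Ŝ t (orig A) (point A B a i)) (+-identityʳ t)
      (path a t 0 (≤-trans (≤-reflexive (+-identityʳ t)) t≤)))

    h-hom : Hom X X h
    h-hom A B a = subst₂ (_~_ X) (sym (h-orig a)) (sym (h-orig a′))
      (F-hom (point-linked a 0) (point-linked a′ 0) N-odd (m≤n+m N 2) (across a))
      where a′ = X-sym A B a

    -- One step down to A, N steps across to B, and one step up.
    f-one : ∀ {A A′ B B′} → _~_ X A B → _~_ X A A′ → _~_ X B B′ → _~_ X (f A A′ 1) (f B B′ 1)
    f-one ab aa′ bb′ = subst₂ (_~_ X) (sym (f-point aa′ 1)) (sym (f-point bb′ 1))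
      (F-hom (point-linked aa′ 1) (point-linked bb′ 1) 2+N-odd ≤-refl
        (walk-length (cong suc (+-comm N 1)) (down aa′ 1 0<N ▹▹ (across ab ▹▹ walk-reverse Step-sym (down bb′ 1 0<N)))))

    -- 2 + t steps lead down to A, and N - t more reach the point at distance t from B on the edge B
    -- A.
    f-two : ∀ {A A′ B} t → 2 + t ≤ N → _~_ X A B → _~_ X A A′ → _~_ X (f A A′ (2 + t)) (f B A t)
    f-two {A} {A′} {B} t t≤ ab aa′ = subst₂ (_~_ X) (sym (f-point aa′ (2 + t))) (sym (f-point ba t))
      (F-hom (point-linked aa′ (2 + t)) (point-linked ba t) 2+N-odd ≤-refl
        (walk-length (cong (2 +_) (m+[n∸m]≡n t≤N)) (down aa′ (2 + t) t≤ ▹▹ walk-reverse Step-sym up)))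
      where
      ba = X-sym A B ab
      t≤N : t ≤ N
      t≤N = ≤-trans (m≤n+m t 2) t≤
      up : Walk Ŝ (N ∸ t) (point B A ba t) (orig A)
      up = subst (Walk Ŝ (N ∸ t) (point B A ba t)) (trans (cong (point B A ba) (m∸n+n≡m t≤N)) (point-tgt ba 0<N))
        (path ba (N ∸ t) t (≤-reflexive (m∸n+n≡m t≤N)))

    f-tgt : ∀ {A B} → _~_ X A B → f A B N ≡ h B
    f-tgt {A} {B} a = trans (f-point a N) (trans (F-cong (point-tgt a 0<N)) (sym (h-orig (X-sym A B a))))

    stretch-bipartite : ¬ ¬ Colorable X 2
    stretch-bipartite = Rigidity.¬¬bipartite X X-irrefl X-sym _≟_ vs ∈-vs
      (proj₁ N-odd) h f nbr?
      (λ {A} {B} a → subst (λ t → f A B t ≡ h B) (proj₂ N-odd) (f-tgt a))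
      h-hom f-one
      (λ t t≤ → f-two t (subst (2 + t ≤_) (sym (proj₂ N-odd)) t≤))

-- Power thickness

Colorable-≤ : ∀ {G c c′} → c ≤ c′ → Colorable G c → Colorable G c′
Colorable-≤ le (f , ok) = (λ v → inject≤ (f v) le) , λ u v e eq → ok u v e (Fin.inject≤-injective le le (f u) (f v) eq)

module _ {G : Graph} where

  at : ∀ {n u v} → Walk G n u v → ℕ → V G
  at {u = u} p       zero    = u
  at {u = u} []      (suc i) = u
  at         (_ ∷ p) (suc i) = at p i

  at-end : ∀ {n u v} (p : Walk G n u v) → at p n ≡ v
  at-end []      = refl
  at-end (_ ∷ p) = at-end p

  at-step : ∀ {n u v} (p : Walk G n u v) i → i < n → _~_ G (at p i) (at p (suc i))
  at-step (e ∷ [])      zero    _        = e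
  at-step (e ∷ (_ ∷ _)) zero    _        = e
  at-step (_ ∷ p)       (suc i) (s≤s lt) = at-step p i lt

  cycle-walk : ∀ {n} → OddCycle G n → Odd n × ∃ λ v → Walk G n v v
  cycle-walk {suc n} (odd , _ , f , _ , edges) = odd , f zero , walk-length (+-comm n 1) (along n 0 (+-identityʳ n) ▹▹ (back ∷ []))
    where
    g : ∀ i → i < suc n → V G
    g i lt = f (fromℕ< lt)
    along : ∀ d i (eq : d + i ≡ n) → Walk G d (g i (s≤s (subst (i ≤_) eq (m≤n+m i d)))) (g n ≤-refl)
    along zero    i refl = []
    along (suc d) i eq   =
      edges _ _ (inj₁ (trans (Fin.toℕ-fromℕ< (s≤s (subst (suc i ≤_) (trans (+-suc d i) eq) (m≤n+m (suc i) d)))) (cong suc (sym (Fin.toℕ-fromℕ< (s≤s (subst (i ≤_) eq (m≤n+m i (suc d))))))))) ∷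
      along d (suc i) (trans (+-suc d i) eq)
    back : _~_ G (g n ≤-refl) (f zero)
    back = edges _ _ (inj₂ (Fin.toℕ-fromℕ< ≤-refl , refl))

module Main (m′ k′ l′ : ℕ) (l≤k : l′ ≤ k′) where

  private
    m k b D : ℕ
    m = 3 + m′
    k = suc k′
    D = suc (2 * k′)
    b = suc (2 * l′)

  open HelicalGraph m 1 k
  open Colour (2 + m′) k′

  X : Graph
  X = H ^ᵍ b

  X-sym : Sym X
  X-sym = power-sym b H-sym

  D-odd : Odd D
  D-odd = k′ , refl

  b-odd : Odd b
  b-odd = l′ , refl

  X-colour : ∀ A B → _~_ X A B → colour A ≢ colour B
  X-colour A B p = colour-wide (walk-≤ H-sym b-odd D-odd (s≤s (*-monoʳ-≤ 2 l≤k)) p)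

  X-irrefl : ∀ A → ¬ _~_ X A A
  X-irrefl A p = X-colour A A p refl

  -- An edge of H pads to a walk of odd length b, so a colouring of X colours H, and m - 1 colours
  -- do not suffice there.
  X-chromatic : ∀ c → Colorable X c → m ≤ c
  X-chromatic c (f , ok) with m ≤? c
  ... | yes le = le
  ... | no ≰   = ⊥-elim (GridVertices.helical-uncolourable m′ k (Colorable-≤ (≤-pred (≰⇒> ≰))
      (f , λ A B e → ok A B (walk-≤ H-sym (0 , refl) b-odd (s≤s z≤n) (e ∷ [])))))

  X-isChromatic : IsChromaticNumber X m
  X-isChromatic = (colour , X-colour) , X-chromatic

  X-nonbipartite : NonBipartite X
  X-nonbipartite col = contradiction (X-chromatic 2 col) λ { (s≤s (s≤s ())) }

  hkey-distinct : ∀ {A B} → _~_ X A B → hkey A ≢ hkey B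
  hkey-distinct {A} {B} p eq = X-irrefl A (subst (_~_ X A) (sym (hkey-injective A B eq)) p)

  -- The path of an edge of X is laid along a walk of length b in H. Adjacency is irrelevant in
  -- `Edge`, so `walk?` recomputes that walk, the same one for all inner vertices.
  place : V (Subdivide X hkey b) → V H
  place (orig A) = A
  place (inner (edge A B _ [ p ]) i _ _) = at (recompute (walk? b A B) p) i

  place-hom : Hom (Subdivide X hkey b) H place
  place-hom P Q (edge A B lt [ p ] , i , s) = locate s
    where
    W : Walk H b A B
    W = recompute (walk? b A B) p
    place-At : ∀ {i P} → At X hkey b (edge A B lt [ p ]) i P → place P ≡ at W i
    place-At atSrc        = refl
    place-At atTgt        = sym (at-end W)
    place-At (atIn _ _ _) = refl
    At-≤ : ∀ {i P} → At X hkey b (edge A B lt [ p ]) i P → i ≤ b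
    At-≤ atSrc        = z≤n
    At-≤ atTgt        = ≤-refl
    At-≤ (atIn _ _ q) = <⇒≤ q
    locate : _ → _~_ H (place P) (place Q)
    locate (inj₁ (x , y)) = subst₂ (_~_ H) (sym (place-At x)) (sym (place-At y)) (at-step W i (At-≤ y))
    locate (inj₂ (x , y)) = H-sym (place Q) (place P) (subst₂ (_~_ H) (sym (place-At y)) (sym (place-At x)) (at-step W i (At-≤ x)))

  -- Both conditions come from `colour-wide`: walks of length D map to H under `place`, and an odd
  -- cycle in X with n b ≤ D would pad to a closed walk of length D in H.
  admissible : Admissible X hkey k′ l′
  admissible =
    (λ { c (col , _) → Colorable-≤ (X-chromatic c col) (colour ∘ place , λ _ _ p → colour-wide (walk-map {f = place} place-hom p)) }) ,
    λ n cyc → below n (cycle-walk cyc)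
    where
    below : ∀ n → (Odd n × ∃ λ A → Walk X n A A) → D < n * b
    below n (n-odd , A , p) with n * b ≤? D
    ... | yes le = ⊥-elim (colour-wide (walk-≤ H-sym (odd-* n-odd b-odd) D-odd le (walk-power b p)) refl)
    ... | no ≰   = ≰⇒> ≰

  module _ (r s : ℕ) (colouring : Colorable (PowerFrac X hkey r s) m) (large : D * suc (2 * s) < suc (2 * r) * b) where

    private
      -- An edge of X is cut into N = w e parts. Coarsening separates colours over u e = D q steps,
      -- as universality asks for walks of length q to become edges of H. Walks of length b q then
      -- become edges of X, and τ = b q / N.
      u w e N q : ℕ
      u = suc (2 * r)
      w = suc (2 * s)
      e = D * b
      N = w * e
      q = u * b

    e-odd : Odd e
    e-odd = odd-* D-odd b-odd

    q-odd : Odd q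
    q-odd = odd-* (r , refl) b-odd

    N-odd : Odd N
    N-odd = odd-* (s , refl) e-odd

    open Paths X N using (Ŝ; Point; Step-sym)
    open Coarse X X-sym hkey (λ {A} {B} → hkey-distinct {A} {B}) w (s≤s z≤n) e e-odd using (coarse; coarse-walk)
    open Stretching X X-irrefl X-sym _≟ᴴ_ vertices ∈-vertices (walk? b) N N-odd using (points; ∈-points; stretch-bipartite)

    c : Point → Fin m
    c P = proj₁ colouring (coarse P)

    c-wide : ∀ {n P Q} → Odd n → n ≤ D * q → Walk Ŝ n P Q → c P ≢ c Q
    c-wide n-odd n≤ p = proj₂ colouring _ _
      (coarse-walk u (walk-length (exchange D u b) (walk-≤ Step-sym n-odd (odd-* D-odd q-odd) n≤ p)))
      where
      exchange : ∀ D u b → D * (u * b) ≡ u * (D * b)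
      exchange = solve-∀

    open Universal m k′ Ŝ Step-sym q q-odd c c-wide

    -- D w and u b are odd, so they differ by at least 2; multiply by b.
    2+N≤bq : 2 + N ≤ b * q
    2+N≤bq = begin
      2 + N           ≤⟨ +-monoˡ-≤ N (*-monoʳ-≤ 2 (s≤s {0} {2 * l′} z≤n)) ⟩
      2 * b + N       ≡⟨ eq b w D ⟩
      b * (2 + D * w) ≤⟨ *-monoʳ-≤ b (odd-< (odd-* D-odd (s , refl)) q-odd large) ⟩
      b * q           ∎
      where
      open ≤-Reasoning
      eq : ∀ b w D → 2 * b + w * (D * b) ≡ b * (2 + D * w)
      eq = solve-∀

    impossible : (∀ P i x → Dec (Seen P i x)) → ⊥
    impossible seen? = stretch-bipartite image
      (λ l l′ n-odd n≤ p → image-walk b l l′ (walk-≤ Step-sym n-odd (odd-* b-odd q-odd) (≤-trans n≤ 2+N≤bq) p))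
      X-nonbipartite
      where open WithDecisions seen?

    triples : List (Point × ℕ × Fin m)
    triples = cartesianProduct points (cartesianProduct (upTo k) (allFin m))

    -- `Seen` is not decided, but a contradiction is sought, so decisions at the finitely many
    -- triples may be assumed.
    too-large : ⊥
    too-large = ¬¬-decidable triples λ dec → impossible (decide dec)
      where
      decide : (∀ {p} → p ∈ triples → Dec (Seen (proj₁ p) (proj₁ (proj₂ p)) (proj₂ (proj₂ p)))) → ∀ P i x → Dec (Seen P i x)
      decide dec P i x with i <? k
      ... | yes i<k = dec (∈-cartesianProduct⁺ (∈-points P) (∈-cartesianProduct⁺ (∈-upTo⁺ i<k) (∈-allFin x)))
      ... | no i≮k  = no (i≮k ∘ proj₁)

  thickness : PowerThicknessIs X hkey D b
  -- The supremum is attained, so the same pair exceeds every smaller fraction.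
  thickness = X-nonbipartite , upper , λ a c _ lt → k′ , l′ , admissible , lt
    where
    upper : ∀ r s → Admissible X hkey r s → suc (2 * r) * b ≤ D * suc (2 * s)
    upper r s (χ≤ , _) with suc (2 * r) * b ≤? D * suc (2 * s)
    ... | yes le = le
    ... | no ≰   = ⊥-elim (too-large r s (χ≤ m X-isChromatic) (≰⇒> ≰))

2*suc∸1 : ∀ n → suc (2 * n) ≡ 2 * suc n ∸ 1
2*suc∸1 n = sym (+-suc n (n + 0))

theorem3p3 : (k l m : ℕ) → 1 ≤ k → 1 ≤ l → 3 ≤ m → 2 * l ∸ 1 ≤ 2 * k ∸ 1 →
    PowerThicknessIs (Helical m 1 k ^ᵍ (2 * l ∸ 1)) hkey (2 * k ∸ 1) (2 * l ∸ 1)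
theorem3p3 (suc k) (suc l) (suc (suc (suc m))) _ _ _ le =
  subst₂ (λ D b → PowerThicknessIs (Helical (3 + m) 1 (suc k) ^ᵍ b) hkey D b) (2*suc∸1 k) (2*suc∸1 l)
    (Main.thickness m k l (*-cancelˡ-≤ 2 (≤-pred (subst₂ _≤_ (sym (2*suc∸1 l)) (sym (2*suc∸1 k)) le))))
theorem3p3 (suc k) (suc l) (suc zero) _ _ (s≤s ())
theorem3p3 (suc k) (suc l) (suc (suc zero)) _ _ (s≤s (s≤s ()))
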